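{- Every finite simple graph on at least three vertices is reconstructible if and only if every $2$-connected graph $G$ such that $\gamma(G)=2$ or $\operatorname{diam}(G)=\operatorname{diam}(\overline{G})=2$ is reconstructible.
   Context: All graphs are finite, simple and undirected. $\gamma(G)$ denotes the domination number, $\operatorname{diam}(G)$ the diameter (infinite if $G$ is disconnected), and $\overline{G}$ the complement of $G$. For a vertex $v$, the card $G-v$ is the unlabeled graph obtained by deleting $v$; the deck $\mathscr{D}(G)$ is the multiset of all cards of $G$ up to isomorphism. $G$ is reconstructible if every graph $H$ with $\mathscr{D}(H)=\mathscr{D}(G)$ is isomorphic to $G$. A graph is $2$-connected if it has at least three vertices and remains connected after deleting any single vertex. -}

module Defs where

open import Data.Bool.Base using (Bool; false; not; _∧_; T)
open import Data.Fin.Base using (Fin; punchIn)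
open import Data.Fin.Permutation using (Permutation; _⟨$⟩ʳ_; _⟨$⟩ˡ_; inverseʳ; flip; _∘ₚ_) renaming (id to idₚ)
open import Data.Fin.Properties using (_≟_)
open import Data.Fin.Subset using (Subset; _∈_; ∣_∣)
open import Data.List.Base using (List; tabulate)
open import Data.Nat.Base using (ℕ; suc; pred; _≤_)
open import Data.Product.Base using (∃; ∃₂; _×_; _,_; proj₂)
open import Data.Sum.Base using (_⊎_)
open import Level using (0ℓ)
open import Relation.Binary.Bundles using (Setoid)
open import Relation.Binary.Construct.Closure.ReflexiveTransitive using (Star; ε; _◅_)
open import Relation.Binary.PropositionalEquality using (_≡_; refl; sym; trans; cong; cong₂)
open import Relation.Nullary using (¬_; does; yes; no; contradiction)
open import Relation.Nullary.Construct.Add.Supremum using (_⁺; [_]; ⊤⁺)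
import Data.List.Relation.Binary.Permutation.Setoid as Permutationₛ
import Relation.Binary.Construct.Add.Supremum.NonStrict as AddSupremum

private
  variable
    m n o : ℕ

record Graph (n : ℕ) : Set where
  field
    adj        : Fin n → Fin n → Bool
    adj-sym    : ∀ u v → adj u v ≡ adj v u
    adj-irrefl : ∀ v → adj v v ≡ false

  Adj : Fin n → Fin n → Set
  Adj u v = T (adj u v)

open Graph public

complement : Graph n → Graph n
complement {n} G = record
  { adj        = co
  ; adj-sym    = co-sym
  ; adj-irrefl = co-irrefl
  }
  where
  co : Fin n → Fin n → Bool
  co u v = not (does (u ≟ v)) ∧ not (adj G u v)

  co-sym : ∀ u v → co u v ≡ co v u
  co-sym u v with u ≟ v | v ≟ u
  ... | yes _   | yes _   = refl
  ... | no  _   | no  _   = cong not (adj-sym G u v)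
  ... | yes u≡v | no  v≢u = contradiction (sym u≡v) v≢u
  ... | no  u≢v | yes v≡u = contradiction (sym v≡u) u≢v

  co-irrefl : ∀ v → co v v ≡ false
  co-irrefl v with v ≟ v
  ... | yes _   = refl
  ... | no  v≢v = contradiction refl v≢v

infixl 6 _-_

-- punchIn v enumerates the vertices other than v.
_-_ : Graph n → Fin n → Graph (pred n)
_-_ {suc n} G v = record
  { adj        = λ a b → adj G (punchIn v a) (punchIn v b)
  ; adj-sym    = λ a b → adj-sym G (punchIn v a) (punchIn v b)
  ; adj-irrefl = λ a → adj-irrefl G (punchIn v a)
  }

infix 4 _≅_

record _≅_ (G : Graph m) (H : Graph n) : Set where
  field
    bijection : Permutation m n
    preserves : ∀ u v → adj H (bijection ⟨$⟩ʳ u) (bijection ⟨$⟩ʳ v) ≡ adj G u v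

open _≅_ public

≅-refl : {G : Graph n} → G ≅ G
≅-refl = record { bijection = idₚ ; preserves = λ _ _ → refl }

≅-sym : {G : Graph m} {H : Graph n} → G ≅ H → H ≅ G
≅-sym {H = H} i = record
  { bijection = flip σ
  ; preserves = λ u v → trans (sym (preserves i (σ ⟨$⟩ˡ u) (σ ⟨$⟩ˡ v)))
                              (cong₂ (adj H) (inverseʳ σ) (inverseʳ σ))
  }
  where σ = bijection i

≅-trans : {G : Graph m} {H : Graph n} {K : Graph o} → G ≅ H → H ≅ K → G ≅ K
≅-trans i j = record
  { bijection = bijection i ∘ₚ bijection j
  ; preserves = λ u v → trans (preserves j (bijection i ⟨$⟩ʳ u) (bijection i ⟨$⟩ʳ v))
                              (preserves i u v)
  }

-- Unlabeled graphs: graphs of arbitrary order, with isomorphism as equality.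
unlabeled : Setoid 0ℓ 0ℓ
unlabeled = record
  { Carrier       = ∃ Graph
  ; _≈_           = λ G H → proj₂ G ≅ proj₂ H
  ; isEquivalence = record { refl = ≅-refl ; sym = ≅-sym ; trans = ≅-trans }
  }

deck : Graph n → List (∃ Graph)
deck {n} G = tabulate (λ v → pred n , G - v)

infix 4 _≈ᵈ_

-- Equality of decks as multisets of unlabeled graphs: the lists of cards agree
-- up to reordering and isomorphism of individual cards.
_≈ᵈ_ : List (∃ Graph) → List (∃ Graph) → Set
_≈ᵈ_ = Permutationₛ._↭_ unlabeled

Reconstructible : Graph n → Set
Reconstructible G = ∀ {m} (H : Graph m) → deck H ≈ᵈ deck G → H ≅ G

Walk : Graph n → Fin n → Fin n → Set
Walk G = Star (Adj G)

length : (G : Graph n) {u v : Fin n} → Walk G u v → ℕ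
length G ε       = 0
length G (_ ◅ w) = suc (length G w)

Connected : Graph n → Set
Connected G = ∀ u v → Walk G u v

TwoConnected : Graph n → Set
TwoConnected {n} G = 3 ≤ n × Connected G × (∀ v → Connected (G - v))

IsDominating : Graph n → Subset n → Set
IsDominating G S = ∀ v → v ∈ S ⊎ ∃ λ u → u ∈ S × Adj G u v

-- γ(G) = k
IsDominationNumber : Graph n → ℕ → Set
IsDominationNumber G k =
  (∃ λ S → IsDominating G S × ∣ S ∣ ≡ k) × (∀ S → IsDominating G S → k ≤ ∣ S ∣)

-- ⊤⁺ is ∞.
ℕ∞ : Set
ℕ∞ = ℕ ⁺

open AddSupremum _≤_ public using () renaming (_≤⁺_ to _≤∞_)

-- d(u,v) = d, where d(u,v) = ∞ if no walk joins u and v.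
IsDistance : Graph n → Fin n → Fin n → ℕ∞ → Set
IsDistance G u v [ k ] =
  (∃ λ (w : Walk G u v) → length G w ≡ k) × (∀ (w : Walk G u v) → k ≤ length G w)
IsDistance G u v ⊤⁺    = ¬ Walk G u v

-- diam(G) = d, the maximum distance, so ∞ when G is disconnected.
IsDiameter : Graph n → ℕ∞ → Set
IsDiameter G d =
  (∃₂ λ u v → IsDistance G u v d) × (∀ u v e → IsDistance G u v e → e ≤∞ d)

{-# OPTIONS --safe #-}
module Submission where

-- Match the cards of G and H, so that G - v ≅ H - v for every vertex v; counting edges then shows that
-- every vertex has the same degree in G and in H, which settles graphs with a universal or an isolated vertex.
-- If neither G nor its complement has a dominating edge, then both have diameter 2 and G is 2-connected.
-- Otherwise let uv be a dominating edge of G, say.  If G is not 2-connected, then u, say, is a cut vertex,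
-- and the complement has a dominating edge as well.  It is 2-connected unless, in G or in the complement,
-- some vertex u is adjacent to all but one vertex x and its deletion leaves a disconnected graph K.
-- So let G be of that form.
-- If K has no isolated vertex, the cards G - y with y outside the component of x in K determine that
-- component with x marked, and this determines G.
-- If K has an isolated vertex t, it is pendant at u in G, and cards can be matched respecting t and u.
-- Let B be the complement of G - t, and attach s pendant vertices to B at u.  By induction on s the deck of
-- this graph is determined, and for s ≥ 1 its complement is 2-connected with domination number at most 2,
-- so the graph itself is determined.  For large s the vertex u is recognised by its degree, so (B , u) is
-- determined, and with it G.

open import Data.Bool.Base using (Bool; true; false; not; T; if_then_else_)
open import Data.Bool.Properties using (not-involutive) renaming (_≟_ to _≟ᵇ_)
open import Data.Empty using (⊥; ⊥-elim)
open import Data.Fin.Base using (Fin; zero; suc; punchIn; punchOut; cast)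
open import Data.Fin.Permutation using (Permutation; permutation; _⟨$⟩ʳ_; _⟨$⟩ˡ_; inverseʳ; inverseˡ; flip; _∘ₚ_; cast-id; transpose; insert; insert-punchIn; remove; punchIn-permute; lift₀; lift₀-remove; ↔⇒≡) renaming (id to idₚ)
open import Data.Fin.Properties using (_≟_; any?; punchInᵢ≢i; punchIn-injective; punchIn-punchOut; suc-injective; cast-involutive)
open import Data.Fin.Subset using (Subset; ⁅_⁆; _∪_; _∈_; _⊃_; ∣_∣)
open import Data.Fin.Subset.Induction using (⊃-wellFounded; Acc; acc)
open import Data.Fin.Subset.Properties using (x∈⁅x⁆; x∈⁅y⁆⇒x≡y; x∈p∪q⁺; x∈p∪q⁻; p⊆p∪q; ∣⁅x⁆∣≡1; p⊂q⇒∣p∣<∣q∣; ∪-identityˡ; ∪-identityʳ; _∈?_)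
open import Data.List.Base using (tabulate; lookup)
open import Data.List.Properties using (length-tabulate; lookup-tabulate)
open import Data.Nat.Base using (ℕ; zero; suc; pred; _+_; _*_; _≤_; _<_; z≤n; s≤s)
open import Data.Nat.Properties using (+-0-commutativeMonoid; +-cancelˡ-≡; +-cancelʳ-≡; +-assoc; *-cancelˡ-≡; +-suc; ≤-trans; ≤-reflexive; m≤n⇒m≤1+n; <⇒≱; n<1+n; m≤n+m)
open import Data.Product.Base using (Σ; ∃; ∃₂; _×_; _,_; proj₁; proj₂; map₂)
open import Data.Sum.Base using (_⊎_; inj₁; inj₂)
open import Data.Unit.Base using (⊤; tt)
open import Function.Base using (_∘_; case_of_)
open import Function.Bundles using (_⇔_; mk⇔; Inverse)
open import Relation.Binary.Construct.Closure.ReflexiveTransitive using (Star; ε; _◅_; _◅◅_; gmap; reverse)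
open import Relation.Binary.PropositionalEquality using (_≡_; _≢_; refl; sym; trans; cong; cong₂; subst; ≢-sym; module ≡-Reasoning)
open import Relation.Nullary using (Dec; does; yes; no; contradiction)
open import Relation.Nullary.Construct.Add.Supremum using ([_]; ⊤⁺)
open import Relation.Nullary.Decidable using (dec-true; dec-false; _×-dec_; ¬?)
open import Defs
open import Algebra.Properties.CommutativeMonoid.Sum +-0-commutativeMonoid using (sum; sum-cong-≗; sum-remove; ∑-distrib-+; sum-permute)
open import Data.List.Relation.Binary.Permutation.Setoid unlabeled using (onIndices; refl)
open import Data.List.Relation.Binary.Permutation.Setoid.Properties unlabeled using (onIndices-lookup)
import Data.List.Relation.Binary.Pointwise as Pointwise
import Relation.Binary.Construct.Add.Supremum.NonStrict as AddSupremum
open AddSupremum _≤_ using () renaming ([_] to [_]≤)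

private
  variable
    m n : ℕ

-- Permutations, Booleans and punched indices

⟨$⟩ʳ-injective : (f : Permutation m n) {a b : Fin m} → f ⟨$⟩ʳ a ≡ f ⟨$⟩ʳ b → a ≡ b
⟨$⟩ʳ-injective f eq = trans (sym (inverseˡ f)) (trans (cong (f ⟨$⟩ˡ_) eq) (inverseˡ f))

true≢false : ∀ {b : Bool} → b ≡ true → b ≡ false → ⊥
true≢false refl ()

adj⇒≢ : (G : Graph n) {a b : Fin n} → adj G a b ≡ true → a ≢ b
adj⇒≢ G {a} e refl = true≢false e (adj-irrefl G a)

punched : {v a : Fin (suc n)} → a ≢ v → ∃ λ i → punchIn v i ≡ a
punched a≢v = punchOut (≢-sym a≢v) , punchIn-punchOut (≢-sym a≢v)

-- Hypomorphisms

-- An isomorphism between the cards G - v and H - v, extended to the whole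
-- vertex set by v ↦ v.
record Card (G H : Graph n) (v : Fin n) : Set where
  field
    perm : Permutation n n
    fix  : perm ⟨$⟩ʳ v ≡ v
    pres : ∀ {a b} → a ≢ v → b ≢ v → adj H (perm ⟨$⟩ʳ a) (perm ⟨$⟩ʳ b) ≡ adj G a b

  avoids : ∀ {a} → a ≢ v → perm ⟨$⟩ʳ a ≢ v
  avoids a≢v eq = a≢v (⟨$⟩ʳ-injective perm (trans eq (sym fix)))

  fixˡ : perm ⟨$⟩ˡ v ≡ v
  fixˡ = trans (cong (perm ⟨$⟩ˡ_) (sym fix)) (inverseˡ perm)

  avoidsˡ : ∀ {a} → a ≢ v → perm ⟨$⟩ˡ a ≢ v
  avoidsˡ a≢v eq = a≢v (trans (sym (inverseʳ perm)) (trans (cong (perm ⟨$⟩ʳ_) eq) fix))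

  presˡ : ∀ {a b} → a ≢ v → b ≢ v → adj G (perm ⟨$⟩ˡ a) (perm ⟨$⟩ˡ b) ≡ adj H a b
  presˡ a≢v b≢v = trans (sym (pres (avoidsˡ a≢v) (avoidsˡ b≢v)))
                        (cong₂ (adj H) (inverseʳ perm) (inverseʳ perm))

open Card public

Hypomorphic : Graph n → Graph n → Set
Hypomorphic G H = ∀ v → Card G H v

Card-sym : {G H : Graph n} {v : Fin n} → Card G H v → Card H G v
Card-sym c = record { perm = flip (perm c) ; fix = fixˡ c ; pres = presˡ c }

-- Moves the deleted vertex: when `i` carries `v` to `w` and `j` carries `w` back to `v`, an
-- isomorphism of the cards at `w` is conjugated to one at `v`.
Card-conj : {G G′ H H′ : Graph n} {v w : Fin n} (i : G′ ≅ G) (c : Card G H w) (j : H ≅ H′) →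
            bijection i ⟨$⟩ʳ v ≡ w → bijection j ⟨$⟩ʳ w ≡ v → Card G′ H′ v
Card-conj {v = v} {w} i c j iv jw = record
  { perm = bijection i ∘ₚ perm c ∘ₚ bijection j
  ; fix  = trans (cong (λ a → bijection j ⟨$⟩ʳ (perm c ⟨$⟩ʳ a)) iv)
                 (trans (cong (bijection j ⟨$⟩ʳ_) (fix c)) jw)
  ; pres = λ a≢v b≢v → trans (preserves j _ _) (trans (pres c (off a≢v) (off b≢v)) (preserves i _ _))
  }
  where
  off : ∀ {a} → a ≢ v → bijection i ⟨$⟩ʳ a ≢ w
  off a≢v e = a≢v (⟨$⟩ʳ-injective (bijection i) (trans e (sym iv)))

fromCard≅ : {G H : Graph (suc n)} {v : Fin (suc n)} → G - v ≅ H - v → Card G H v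
fromCard≅ {n} {G} {H} {v} i = record
  { perm = insert v v (bijection i)
  ; fix  = fix′
  ; pres = pres′
  }
  where
  fix′ : insert v v (bijection i) ⟨$⟩ʳ v ≡ v
  fix′ with v ≟ v
  ... | yes _   = refl
  ... | no  v≢v = contradiction refl v≢v
  pres′ : ∀ {a b} → a ≢ v → b ≢ v →
          adj H (insert v v (bijection i) ⟨$⟩ʳ a) (insert v v (bijection i) ⟨$⟩ʳ b) ≡ adj G a b
  pres′ a≢v b≢v with punched a≢v | punched b≢v
  ... | j , refl | k , refl =
    trans (cong₂ (adj H) (insert-punchIn v v (bijection i) j) (insert-punchIn v v (bijection i) k))
          (preserves i j k)

toCard≅ : {G H : Graph (suc n)} {v : Fin (suc n)} → Card G H v → G - v ≅ H - v
toCard≅ {n} {G} {H} {v} c = record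
  { bijection = remove v (perm c)
  ; preserves = λ j k → trans (cong₂ (adj H) (shift j) (shift k))
                              (pres c (punchInᵢ≢i v j) (punchInᵢ≢i v k))
  }
  where
  shift : ∀ j → punchIn v (remove v (perm c) ⟨$⟩ʳ j) ≡ perm c ⟨$⟩ʳ punchIn v j
  shift j = trans (cong (λ w → punchIn w (remove v (perm c) ⟨$⟩ʳ j)) (sym (fix c)))
                  (sym (punchIn-permute (perm c) v j))

relabel : Permutation m n → Graph n → Graph m
relabel π G = record
  { adj        = λ a b → adj G (π ⟨$⟩ʳ a) (π ⟨$⟩ʳ b)
  ; adj-sym    = λ a b → adj-sym G _ _
  ; adj-irrefl = λ a → adj-irrefl G _
  }

relabel-≅ : (π : Permutation m n) (G : Graph n) → relabel π G ≅ G
relabel-≅ π G = record { bijection = π ; preserves = λ _ _ → refl }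

relabel-card-≅ : (π : Permutation (suc m) (suc n)) (G : Graph (suc n)) (v : Fin (suc m)) →
                 relabel π G - v ≅ G - (π ⟨$⟩ʳ v)
relabel-card-≅ π G v = record
  { bijection = remove v π
  ; preserves = λ j k → sym (cong₂ (adj G) (punchIn-permute π v j) (punchIn-permute π v k))
  }

Hypomorphic⇒≈ᵈ : {G H : Graph n} → Hypomorphic G H → deck H ≈ᵈ deck G
Hypomorphic⇒≈ᵈ {zero}  h = refl Pointwise.[]
Hypomorphic⇒≈ᵈ {suc n} h = refl (Pointwise.tabulate⁺ λ v → toCard≅ (Card-sym (h v)))

-- A proof of `_≈ᵈ_` contains a bijection between the positions of the two lists; the casts identify
-- positions in a tabulated deck with vertices.
≈ᵈ⇒matching : {H : Graph m} {G : Graph n} → deck H ≈ᵈ deck G →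
              Σ (Permutation m n) λ σ → ∀ v → H - v ≅ G - (σ ⟨$⟩ʳ v)
≈ᵈ⇒matching {m} {n} {H} {G} p = σ , match
  where
  eqH = length-tabulate {n = m} (λ v → pred m , H - v)
  eqG = length-tabulate {n = n} (λ v → pred n , G - v)
  σ : Permutation m n
  σ = cast-id (sym eqH) ∘ₚ onIndices p ∘ₚ cast-id eqG
  look : ∀ {k} (f : Fin k → ∃ Graph) (i : Fin k) → lookup (tabulate f) (cast (sym (length-tabulate f)) i) ≡ f i
  look f i = lookup-tabulate f i
  match : ∀ v → H - v ≅ G - (σ ⟨$⟩ʳ v)
  match v = subst (λ K → proj₂ K ≅ G - (σ ⟨$⟩ʳ v)) (look (λ v → pred m , H - v) v)
           (subst (λ K → proj₂ (lookup (deck H) (cast (sym eqH) v)) ≅ proj₂ K)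
             (trans (cong (lookup (deck G)) (sym (cast-involutive (sym eqG) eqG (Inverse.to (onIndices p) (cast (sym eqH) v)))))
                    (look (λ v → pred n , G - v) (σ ⟨$⟩ʳ v)))
             (onIndices-lookup p (cast (sym eqH) v)))

-- The matching `σ` forces equal orders, and relabelling `H` along it turns it into the identity.
≈ᵈ⇒Hypomorphic : {H : Graph m} {G : Graph (suc n)} → deck H ≈ᵈ deck G →
                 ∃ λ H′ → H′ ≅ H × Hypomorphic G H′
≈ᵈ⇒Hypomorphic {H = H} {G = G} p with ≈ᵈ⇒matching {H = H} {G = G} p
... | σ , match with ↔⇒≡ σ
... | refl = relabel (flip σ) H , relabel-≅ (flip σ) H ,
  λ v → fromCard≅ (≅-trans (subst (λ w → G - w ≅ H - (σ ⟨$⟩ˡ v)) (inverseʳ σ) (≅-sym (match (σ ⟨$⟩ˡ v))))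
                           (≅-sym (relabel-card-≅ (flip σ) H v)))

-- Degrees

ι : Bool → ℕ
ι true  = 1
ι false = 0

count : (Fin n → Bool) → ℕ
count g = sum (ι ∘ g)

count-none : (g : Fin n → Bool) → (∀ i → g i ≡ false) → count g ≡ 0
count-none {zero}  g none = refl
count-none {suc n} g none rewrite none zero = count-none (g ∘ suc) (none ∘ suc)

count≡0 : (g : Fin n → Bool) → count g ≡ 0 → ∀ i → g i ≡ false
count≡0 g e zero with g zero
... | false = refl
count≡0 g e (suc i) with g zero
... | false = count≡0 (g ∘ suc) e i

count-unique : (g : Fin n → Bool) (i : Fin n) → g i ≡ true → (∀ j → j ≢ i → g j ≡ false) → count g ≡ 1
count-unique {suc n} g i gi others = trans (sum-remove {i = i} (ι ∘ g))
  (cong₂ _+_ (cong ι gi) (count-none (g ∘ punchIn i) λ j → others _ (punchInᵢ≢i i j)))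

count≡1 : (g : Fin n → Bool) → count g ≡ 1 → ∃ λ i → g i ≡ true × (∀ j → j ≢ i → g j ≡ false)
count≡1 {suc n} g e with g zero in g0
... | true  = zero , g0 , λ { zero 0≢0 → contradiction refl 0≢0 ; (suc j) _ → count≡0 (g ∘ suc) (cong pred e) j }
... | false with count≡1 (g ∘ suc) e
...   | i , gi , others = suc i , gi , λ { zero _ → g0 ; (suc j) ne → others j (ne ∘ cong suc) }

deg : Graph n → Fin n → ℕ
deg G v = count (adj G v)

degreeSum : Graph n → ℕ
degreeSum G = sum (deg G)

deg-≅ : {G : Graph m} {H : Graph n} (i : G ≅ H) (v : Fin m) → deg H (bijection i ⟨$⟩ʳ v) ≡ deg G v
deg-≅ {H = H} i v = trans (sum-permute (ι ∘ adj H (bijection i ⟨$⟩ʳ v)) (bijection i))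
                          (sum-cong-≗ λ b → cong ι (preserves i v b))

degreeSum-≅ : {G : Graph m} {H : Graph n} → G ≅ H → degreeSum H ≡ degreeSum G
degreeSum-≅ {H = H} i = trans (sum-permute (deg H) (bijection i)) (sum-cong-≗ (deg-≅ i))

-- Every edge at `v` contributes twice to the degree sum, once at `v` and once at its other end.
degreeSum-card : (G : Graph (suc n)) (v : Fin (suc n)) → degreeSum G ≡ deg G v + (deg G v + degreeSum (G - v))
degreeSum-card {n} G v = begin
  degreeSum G
    ≡⟨ sum-remove {i = v} (deg G) ⟩
  deg G v + sum (λ j → deg G (punchIn v j))
    ≡⟨ cong (deg G v +_) (sum-cong-≗ λ j → sum-remove {i = v} (ι ∘ adj G (punchIn v j))) ⟩
  deg G v + sum (λ j → ι (adj G (punchIn v j) v) + deg (G - v) j)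
    ≡⟨ cong (deg G v +_) (∑-distrib-+ (λ j → ι (adj G (punchIn v j) v)) (deg (G - v))) ⟩
  deg G v + (sum (λ j → ι (adj G (punchIn v j) v)) + degreeSum (G - v))
    ≡⟨ cong (λ s → deg G v + (s + degreeSum (G - v))) (sum-cong-≗ λ j → cong ι (adj-sym G (punchIn v j) v)) ⟩
  deg G v + (sum (λ j → ι (adj G v (punchIn v j))) + degreeSum (G - v))
    ≡⟨ cong (λ s → deg G v + (s + degreeSum (G - v))) (sym deg-punch) ⟩
  deg G v + (deg G v + degreeSum (G - v)) ∎
  where
  open ≡-Reasoning
  deg-punch : deg G v ≡ sum (λ j → ι (adj G v (punchIn v j)))
  deg-punch = trans (sum-remove {i = v} (ι ∘ adj G v))
                    (cong (λ b → ι b + sum (λ j → ι (adj G v (punchIn v j)))) (adj-irrefl G v))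

sum-const : ∀ n c → sum {n} (λ _ → c) ≡ n * c
sum-const zero    c = refl
sum-const (suc n) c = cong (c +_) (sum-const n c)

-- Summing degreeSum-card over all v gives (n ∸ 2) · degreeSum G as a sum over the cards.
degreeSum-cards : (G : Graph (suc (suc n))) → n * degreeSum G ≡ sum (λ v → degreeSum (G - v))
degreeSum-cards {n} G = +-cancelˡ-≡ D _ _ (+-cancelˡ-≡ D _ _ (begin
  D + (D + n * D)
    ≡⟨ sum-const (suc (suc n)) D ⟨
  sum (λ (_ : Fin (suc (suc n))) → D)
    ≡⟨ sum-cong-≗ (degreeSum-card G) ⟩
  sum (λ v → deg G v + (deg G v + degreeSum (G - v)))
    ≡⟨ ∑-distrib-+ (deg G) (λ v → deg G v + degreeSum (G - v)) ⟩
  D + sum (λ v → deg G v + degreeSum (G - v))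
    ≡⟨ cong (D +_) (∑-distrib-+ (deg G) (λ v → degreeSum (G - v))) ⟩
  D + (D + sum (λ v → degreeSum (G - v))) ∎))
  where
  open ≡-Reasoning
  D = degreeSum G

-- The cards determine the degree sum of the graph because the factor `suc n` can be cancelled,
-- which is where three vertices are used. `degreeSum-card` then isolates the degree of the deleted
-- vertex.
deg-hypo : {G H : Graph (suc (suc (suc n)))} → Hypomorphic G H → ∀ v → deg H v ≡ deg G v
deg-hypo {n} {G} {H} h v = double-cancel (deg H v) (deg G v) (degreeSum (G - v)) (begin
  deg H v + (deg H v + degreeSum (G - v))
    ≡⟨ cong (λ s → deg H v + (deg H v + s)) (cardSum v) ⟨
  deg H v + (deg H v + degreeSum (H - v))
    ≡⟨ degreeSum-card H v ⟨
  degreeSum H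
    ≡⟨ *-cancelˡ-≡ _ _ (suc n) (trans (degreeSum-cards H) (trans (sum-cong-≗ cardSum) (sym (degreeSum-cards G)))) ⟩
  degreeSum G
    ≡⟨ degreeSum-card G v ⟩
  deg G v + (deg G v + degreeSum (G - v)) ∎)
  where
  open ≡-Reasoning
  cardSum : ∀ w → degreeSum (H - w) ≡ degreeSum (G - w)
  cardSum w = degreeSum-≅ (toCard≅ (h w))
  double-cancel : ∀ a b c → a + (a + c) ≡ b + (b + c) → a ≡ b
  double-cancel zero    zero    c e = refl
  double-cancel zero    (suc b) c e = contradiction (+-cancelʳ-≡ c 0 _ (trans e (sym (+-assoc (suc b) (suc b) c)))) λ ()
  double-cancel (suc a) zero    c e = contradiction (+-cancelʳ-≡ c 0 _ (trans (sym e) (sym (+-assoc (suc a) (suc a) c)))) λ ()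
  double-cancel (suc a) (suc b) c e = cong suc (double-cancel a b c
    (cong pred (trans (sym (+-suc a (a + c))) (trans (cong pred e) (+-suc b (b + c))))))

Isolated : Graph n → Fin n → Set
Isolated G t = ∀ b → adj G t b ≡ false

Pendant : Graph n → Fin n → Fin n → Set
Pendant G t u = adj G t u ≡ true × (∀ b → b ≢ u → adj G t b ≡ false)

abstract
  isolated-hypo : {G H : Graph (suc (suc (suc n)))} → Hypomorphic G H → ∀ {t} → Isolated G t → Isolated H t
  isolated-hypo {G = G} {H} h {t} iso = count≡0 (adj H t) (trans (deg-hypo h t) (count-none (adj G t) iso))

  -- Only the degree is transferred, so the neighbour `u′` in `H` may differ from `u`.
  pendant-hypo : {G H : Graph (suc (suc (suc n)))} → Hypomorphic G H → ∀ {t u} → Pendant G t u → ∃ λ u′ → Pendant H t u′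
  pendant-hypo {G = G} {H} h {t} {u} (tu , others) =
    count≡1 (adj H t) (trans (deg-hypo h t) (count-unique (adj G t) u tu others))

-- Complements

co-≢ : (G : Graph n) {a b : Fin n} → a ≢ b → adj (complement G) a b ≡ not (adj G a b)
co-≢ G {a} {b} a≢b rewrite dec-false (a ≟ b) a≢b = refl

co-true : (G : Graph n) {a b : Fin n} → a ≢ b → adj G a b ≡ false → adj (complement G) a b ≡ true
co-true G a≢b e = trans (co-≢ G a≢b) (cong not e)

co-true⁻¹ : (G : Graph n) {a b : Fin n} → adj (complement G) a b ≡ true → adj G a b ≡ false
co-true⁻¹ G e = trans (sym (not-involutive _)) (cong not (trans (sym (co-≢ G (adj⇒≢ (complement G) e))) e))

co-false : (G : Graph n) {a b : Fin n} → adj G a b ≡ true → adj (complement G) a b ≡ false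
co-false G e = trans (co-≢ G (adj⇒≢ G e)) (cong not e)

co-false⁻¹ : (G : Graph n) {a b : Fin n} → a ≢ b → adj (complement G) a b ≡ false → adj G a b ≡ true
co-false⁻¹ G a≢b e = trans (sym (not-involutive _)) (cong not (trans (sym (co-≢ G a≢b)) e))

complement-card : {G H : Graph n} {v : Fin n} → Card G H v → Card (complement G) (complement H) v
complement-card {G = G} {H} {v} c = record { perm = perm c ; fix = fix c ; pres = pres′ }
  where
  pres′ : ∀ {a b} → a ≢ v → b ≢ v →
          adj (complement H) (perm c ⟨$⟩ʳ a) (perm c ⟨$⟩ʳ b) ≡ adj (complement G) a b
  pres′ {a} {b} a≢v b≢v = case a ≟ b of λ where
    (yes refl) → trans (adj-irrefl (complement H) _) (sym (adj-irrefl (complement G) _))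
    (no  a≢b)  → trans (co-≢ H (a≢b ∘ ⟨$⟩ʳ-injective (perm c)))
                         (trans (cong not (pres c a≢v b≢v)) (sym (co-≢ G a≢b)))

complement-hypo : {G H : Graph n} → Hypomorphic G H → Hypomorphic (complement G) (complement H)
complement-hypo h v = complement-card (h v)

complement-≅ : {G H : Graph n} → G ≅ H → complement G ≅ complement H
complement-≅ {G = G} {H} i = record { bijection = f ; preserves = pres′ }
  where
  f = bijection i
  pres′ : ∀ a b → adj (complement H) (f ⟨$⟩ʳ a) (f ⟨$⟩ʳ b) ≡ adj (complement G) a b
  pres′ a b = case a ≟ b of λ where
    (yes refl) → trans (adj-irrefl (complement H) _) (sym (adj-irrefl (complement G) _))
    (no  a≢b)  → trans (co-≢ H (a≢b ∘ ⟨$⟩ʳ-injective f)) (trans (cong not (preserves i a b)) (sym (co-≢ G a≢b)))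

complement-≅⁻¹ : {G H : Graph n} → complement G ≅ complement H → G ≅ H
complement-≅⁻¹ {G = G} {H} i = record { bijection = f ; preserves = pres′ }
  where
  f = bijection i
  pres′ : ∀ a b → adj H (f ⟨$⟩ʳ a) (f ⟨$⟩ʳ b) ≡ adj G a b
  pres′ a b = case a ≟ b of λ where
    (yes refl) → trans (adj-irrefl H _) (sym (adj-irrefl G _))
    (no  a≢b)  → trans (sym (not-involutive _)) (trans (cong not
      (trans (sym (co-≢ H (a≢b ∘ ⟨$⟩ʳ-injective f))) (trans (preserves i a b) (co-≢ G a≢b)))) (not-involutive _))

-- Vertices with exactly one non-neighbour, and universal vertices

record Misses (G : Graph n) (u x : Fin n) : Set where
  constructor mkMisses
  field
    distinct : u ≢ x
    missed   : adj G u x ≡ false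
    others   : ∀ b → b ≢ u → b ≢ x → adj G u b ≡ true

open Misses public

misses-unique : {G : Graph n} {u x : Fin n} → Misses G u x → ∀ {b} → b ≢ u → adj G u b ≡ false → b ≡ x
misses-unique {x = x} m {b} b≢u e with b ≟ x
... | yes b≡x = b≡x
... | no  b≢x = ⊥-elim (true≢false (others m b b≢u b≢x) e)

misses⇒pendant : {G : Graph n} {u x : Fin n} → Misses G u x → Pendant (complement G) u x
misses⇒pendant {G = G} {u} m = co-true G (distinct m) (missed m) , others′
  where
  others′ : ∀ b → b ≢ _ → adj (complement G) u b ≡ false
  others′ b b≢x = case b ≟ u of λ where
    (yes refl) → adj-irrefl (complement G) b
    (no  b≢u)  → co-false G (others m b b≢u b≢x)

pendant⇒misses : {G : Graph n} {u x : Fin n} → Pendant (complement G) u x → Misses G u x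
pendant⇒misses {G = G} {u} (e , none) = mkMisses (adj⇒≢ (complement G) e) (co-true⁻¹ G e)
  λ b b≢u b≢x → co-false⁻¹ G (≢-sym b≢u) (none b b≢x)

-- Degrees are compared in the complements, where `u` is pendant; as there, `x′` may differ from
-- `x`.
misses-hypo : {G H : Graph (suc (suc (suc n)))} → Hypomorphic G H → ∀ {u x} → Misses G u x → ∃ λ x′ → Misses H u x′
misses-hypo {G = G} {H} h m =
  map₂ pendant⇒misses (pendant-hypo {G = complement G} {H = complement H} (complement-hypo h) (misses⇒pendant m))

Universal : Graph n → Fin n → Set
Universal G u = ∀ b → b ≢ u → adj G u b ≡ true

extend-card : {G H : Graph n} {v : Fin n} (c : Card G H v) →
              (∀ b → b ≢ v → adj H v (perm c ⟨$⟩ʳ b) ≡ adj G v b) → G ≅ H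
extend-card {G = G} {H} {v} c row = record { bijection = perm c ; preserves = pres′ }
  where
  row′ : ∀ b → adj H (perm c ⟨$⟩ʳ v) (perm c ⟨$⟩ʳ b) ≡ adj G v b
  row′ b with b ≟ v
  ... | yes refl = trans (adj-irrefl H _) (sym (adj-irrefl G _))
  ... | no  b≢v  = trans (cong (λ w → adj H w (perm c ⟨$⟩ʳ b)) (fix c)) (row b b≢v)
  pres′ : ∀ a b → adj H (perm c ⟨$⟩ʳ a) (perm c ⟨$⟩ʳ b) ≡ adj G a b
  pres′ a b with a ≟ v | b ≟ v
  ... | yes refl | _        = row′ b
  ... | no  _    | yes refl = trans (adj-sym H _ _) (trans (row′ a) (adj-sym G v a))
  ... | no  a≢v  | no  b≢v  = pres c a≢v b≢v

-- In the complement `u` is isolated, so comparing degrees makes `u` universal in `H` too, and any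
-- isomorphism of the cards at `u` extends.
universal-≅ : {G H : Graph (suc (suc (suc n)))} → Hypomorphic G H → ∀ {u} → Universal G u → G ≅ H
universal-≅ {G = G} {H} h {u} univ = extend-card (h u)
  λ b b≢u → trans (univH _ (avoids (h u) b≢u)) (sym (univ b b≢u))
  where
  isoG : Isolated (complement G) u
  isoG b = case b ≟ u of λ where
    (yes refl) → adj-irrefl (complement G) b
    (no  b≢u)  → co-false G (univ b b≢u)
  univH : Universal H u
  univH b b≢u = co-false⁻¹ H (≢-sym b≢u) (isolated-hypo {G = complement G} {H = complement H} (complement-hypo h) isoG b)

-- Correcting an isomorphism by an automorphism

abstract
  swap : Fin n → Fin n → Permutation n n
  swap = transpose

  swap-matchˡ : (p q : Fin n) → swap p q ⟨$⟩ʳ p ≡ q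
  swap-matchˡ p q rewrite dec-true (p ≟ p) refl = refl

  swap-other : (p q : Fin n) {a : Fin n} → a ≢ p → a ≢ q → swap p q ⟨$⟩ʳ a ≡ a
  swap-other p q {a} a≢p a≢q rewrite dec-false (a ≟ p) a≢p | dec-false (a ≟ q) a≢q = refl

  swap-matchʳ : (p q : Fin n) → swap p q ⟨$⟩ʳ q ≡ p
  swap-matchʳ p q with q ≟ p
  ... | yes q≡p = q≡p
  ... | no  q≢p rewrite dec-true (q ≟ q) refl = refl

data SwapView (p q a : Fin n) : Set where
  atˡ  : a ≡ p → swap p q ⟨$⟩ʳ a ≡ q → SwapView p q a
  atʳ  : a ≡ q → swap p q ⟨$⟩ʳ a ≡ p → SwapView p q a
  else : a ≢ p → a ≢ q → swap p q ⟨$⟩ʳ a ≡ a → SwapView p q a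

swapView : (p q a : Fin n) → SwapView p q a
swapView p q a with a ≟ p | a ≟ q
... | yes refl | _        = atˡ refl (swap-matchˡ a q)
... | no _     | yes refl = atʳ refl (swap-matchʳ p a)
... | no a≢p   | no a≢q   = else a≢p a≢q (swap-other p q a≢p a≢q)

-- `P` describes the vertices that are present, such as those left after deleting `v`. Whether `p`
-- and `q` are adjacent is left open.
Twins : Graph n → (Fin n → Set) → Fin n → Fin n → Set
Twins H P p q = ∀ c → P c → c ≢ p → c ≢ q → adj H p c ≡ adj H q c

twins-swap : {H : Graph n} {P : Fin n → Set} {p q : Fin n} → Twins H P p q →
                  ∀ {a b} → P a → P b → adj H (swap p q ⟨$⟩ʳ a) (swap p q ⟨$⟩ʳ b) ≡ adj H a b
twins-swap {H = H} {p = p} {q} tw {a} {b} Pa Pb with swapView p q a | swapView p q b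
... | atˡ refl ea     | atˡ refl eb     = trans (adj-irrefl H _) (sym (adj-irrefl H _))
... | atˡ refl ea     | atʳ refl eb     = trans (cong₂ (adj H) ea eb) (adj-sym H _ _)
... | atˡ refl ea     | else b≢p b≢q eb = trans (cong₂ (adj H) ea eb) (sym (tw b Pb b≢p b≢q))
... | atʳ refl ea     | atˡ refl eb     = trans (cong₂ (adj H) ea eb) (adj-sym H _ _)
... | atʳ refl ea     | atʳ refl eb     = trans (adj-irrefl H _) (sym (adj-irrefl H _))
... | atʳ refl ea     | else b≢p b≢q eb = trans (cong₂ (adj H) ea eb) (tw b Pb b≢p b≢q)
... | else a≢p a≢q ea | atˡ refl eb     = trans (cong₂ (adj H) ea eb) (trans (adj-sym H _ _) (trans (sym (tw a Pa a≢p a≢q)) (adj-sym H _ _)))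
... | else a≢p a≢q ea | atʳ refl eb     = trans (cong₂ (adj H) ea eb) (trans (adj-sym H _ _) (trans (tw a Pa a≢p a≢q) (adj-sym H _ _)))
... | else a≢p a≢q ea | else b≢p b≢q eb = cong₂ (adj H) ea eb

-- Exchanging twins is an automorphism of `H - v`. Composing with it moves the image `p` of some
-- vertex to the place `q` where it is wanted.
swapTwins : {G H : Graph n} {v : Fin n} (c : Card G H v) {p q : Fin n} → p ≢ v → q ≢ v → Twins H (_≢ v) p q → Card G H v
swapTwins {H = H} c {p} {q} p≢v q≢v tw = record
  { perm = perm c ∘ₚ swap p q
  ; fix  = trans (cong (swap p q ⟨$⟩ʳ_) (fix c)) (swap-other p q (≢-sym p≢v) (≢-sym q≢v))
  ; pres = λ a≢v b≢v → trans (twins-swap {H = H} tw (avoids c a≢v) (avoids c b≢v)) (pres c a≢v b≢v)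
  }

-- u – w is the middle edge of an induced path t – u – w – s in the subgraph induced by P,
-- where every further vertex is adjacent to u and w but not to t and s.
record Bow (H : Graph n) (P : Fin n → Set) (u w t s : Fin n) : Set where
  field
    u≢w : u ≢ w
    t≢u : t ≢ u
    t≢w : t ≢ w
    s≢u : s ≢ u
    s≢w : s ≢ w
    t≢s : t ≢ s
    rowu : ∀ c → P c → c ≢ u → c ≢ s → adj H u c ≡ true
    roww : ∀ c → P c → c ≢ w → c ≢ t → adj H w c ≡ true
    rowt : ∀ c → P c → c ≢ u → adj H t c ≡ false
    rows : ∀ c → P c → c ≢ w → adj H s c ≡ false

-- The reversal of the path of a bow.
flipBow : (u w t s : Fin n) → Permutation n n
flipBow u w t s = swap u w ∘ₚ swap t s

module _ {H : Graph n} {P : Fin n → Set} {u w t s : Fin n} (bow : Bow H P u w t s) where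
  open Bow bow

  private
    σ = flipBow u w t s

  flipBow-u : σ ⟨$⟩ʳ u ≡ w
  flipBow-u = trans (cong (swap t s ⟨$⟩ʳ_) (swap-matchˡ u w)) (swap-other t s (≢-sym t≢w) (≢-sym s≢w))

  flipBow-w : σ ⟨$⟩ʳ w ≡ u
  flipBow-w = trans (cong (swap t s ⟨$⟩ʳ_) (swap-matchʳ u w)) (swap-other t s (≢-sym t≢u) (≢-sym s≢u))

  flipBow-t : σ ⟨$⟩ʳ t ≡ s
  flipBow-t = trans (cong (swap t s ⟨$⟩ʳ_) (swap-other u w t≢u t≢w)) (swap-matchˡ t s)

  flipBow-s : σ ⟨$⟩ʳ s ≡ t
  flipBow-s = trans (cong (swap t s ⟨$⟩ʳ_) (swap-other u w s≢u s≢w)) (swap-matchʳ t s)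

  flipBow-other : ∀ {a} → a ≢ u → a ≢ w → a ≢ t → a ≢ s → σ ⟨$⟩ʳ a ≡ a
  flipBow-other a≢u a≢w a≢t a≢s =
    trans (cong (swap t s ⟨$⟩ʳ_) (swap-other u w a≢u a≢w)) (swap-other t s a≢t a≢s)

  private
    data View (a : Fin n) : Set where
      isu : a ≡ u → View a
      isw : a ≡ w → View a
      ist : a ≡ t → View a
      iss : a ≡ s → View a
      no4 : a ≢ u → a ≢ w → a ≢ t → a ≢ s → View a

    view : ∀ a → View a
    view a with a ≟ u | a ≟ w | a ≟ t | a ≟ s
    ... | yes e | _     | _     | _     = isu e
    ... | no _  | yes e | _     | _     = isw e
    ... | no _  | no _  | yes e | _     = ist e
    ... | no _  | no _  | no _  | yes e = iss e
    ... | no p  | no q  | no r  | no o  = no4 p q r o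

  module _ (Pu : P u) (Pw : P w) (Pt : P t) (Ps : P s) where
    private
      row-u : ∀ b → P b → adj H w (σ ⟨$⟩ʳ b) ≡ adj H u b
      row-u b Pb with view b
      ... | isu refl = trans (cong (adj H w) flipBow-u) (trans (adj-irrefl H _) (sym (adj-irrefl H _)))
      ... | isw refl = trans (cong (adj H w) flipBow-w) (adj-sym H _ _)
      ... | ist refl = trans (cong (adj H w) flipBow-t) (trans (roww s Ps s≢w (≢-sym t≢s)) (sym (rowu t Pt t≢u t≢s)))
      ... | iss refl = trans (cong (adj H w) flipBow-s) (trans (adj-sym H w t)
        (trans (rowt w Pw (≢-sym u≢w)) (trans (sym (rows u Pu u≢w)) (adj-sym H s u))))
      ... | no4 p q r o = trans (cong (adj H w) (flipBow-other p q r o)) (trans (roww b Pb q r) (sym (rowu b Pb p o)))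

      row-w : ∀ b → P b → adj H u (σ ⟨$⟩ʳ b) ≡ adj H w b
      row-w b Pb with view b
      ... | isu refl = trans (cong (adj H u) flipBow-u) (adj-sym H _ _)
      ... | isw refl = trans (cong (adj H u) flipBow-w) (trans (adj-irrefl H _) (sym (adj-irrefl H _)))
      ... | ist refl = trans (cong (adj H u) flipBow-t) (trans (adj-sym H u s)
        (trans (rows u Pu u≢w) (trans (sym (rowt w Pw (≢-sym u≢w))) (adj-sym H t w))))
      ... | iss refl = trans (cong (adj H u) flipBow-s) (trans (rowu t Pt t≢u t≢s) (sym (roww s Ps s≢w (≢-sym t≢s))))
      ... | no4 p q r o = trans (cong (adj H u) (flipBow-other p q r o)) (trans (rowu b Pb p o) (sym (roww b Pb q r)))

      row-t : ∀ b → P b → adj H s (σ ⟨$⟩ʳ b) ≡ adj H t b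
      row-t b Pb with view b
      ... | isu refl = trans (cong (adj H s) flipBow-u) (trans (trans (adj-sym H s w) (roww s Ps s≢w (≢-sym t≢s)))
        (sym (trans (adj-sym H t u) (rowu t Pt t≢u t≢s))))
      ... | isw refl = trans (cong (adj H s) flipBow-w) (trans (rows u Pu u≢w) (sym (rowt w Pw (≢-sym u≢w))))
      ... | ist refl = trans (cong (adj H s) flipBow-t) (trans (adj-irrefl H _) (sym (adj-irrefl H _)))
      ... | iss refl = trans (cong (adj H s) flipBow-s) (adj-sym H _ _)
      ... | no4 p q r o = trans (cong (adj H s) (flipBow-other p q r o)) (trans (rows b Pb q) (sym (rowt b Pb p)))

      row-s : ∀ b → P b → adj H t (σ ⟨$⟩ʳ b) ≡ adj H s b
      row-s b Pb with view b
      ... | isu refl = trans (cong (adj H t) flipBow-u) (trans (rowt w Pw (≢-sym u≢w)) (sym (rows u Pu u≢w)))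
      ... | isw refl = trans (cong (adj H t) flipBow-w) (trans (trans (adj-sym H t u) (rowu t Pt t≢u t≢s))
        (sym (trans (adj-sym H s w) (roww s Ps s≢w (≢-sym t≢s)))))
      ... | ist refl = trans (cong (adj H t) flipBow-t) (adj-sym H _ _)
      ... | iss refl = trans (cong (adj H t) flipBow-s) (trans (adj-irrefl H _) (sym (adj-irrefl H _)))
      ... | no4 p q r o = trans (cong (adj H t) (flipBow-other p q r o)) (trans (rowt b Pb p) (sym (rows b Pb q)))

      -- The left summand is the case of `a` off the path. A pair with an end on the path is settled
      -- from that end, either end serving by symmetry; a pair off the path is fixed.
      row : ∀ {a b} → View a → P b → a ≢ u × a ≢ w × a ≢ t × a ≢ s ⊎ adj H (σ ⟨$⟩ʳ a) (σ ⟨$⟩ʳ b) ≡ adj H a b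
      row {b = b} (isu refl) Pb = inj₂ (trans (cong (λ x → adj H x (σ ⟨$⟩ʳ b)) flipBow-u) (row-u b Pb))
      row {b = b} (isw refl) Pb = inj₂ (trans (cong (λ x → adj H x (σ ⟨$⟩ʳ b)) flipBow-w) (row-w b Pb))
      row {b = b} (ist refl) Pb = inj₂ (trans (cong (λ x → adj H x (σ ⟨$⟩ʳ b)) flipBow-t) (row-t b Pb))
      row {b = b} (iss refl) Pb = inj₂ (trans (cong (λ x → adj H x (σ ⟨$⟩ʳ b)) flipBow-s) (row-s b Pb))
      row (no4 p q r o) _ = inj₁ (p , q , r , o)

    flipBow-pres : ∀ {a b} → P a → P b → adj H (σ ⟨$⟩ʳ a) (σ ⟨$⟩ʳ b) ≡ adj H a b
    flipBow-pres {a} {b} Pa Pb with row (view a) Pb | row (view b) Pa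
    ... | inj₂ e               | _                       = e
    ... | inj₁ _               | inj₂ e                  = trans (adj-sym H _ _) (trans e (adj-sym H b a))
    ... | inj₁ (p , q , r , o) | inj₁ (p′ , q′ , r′ , o′) = cong₂ (adj H) (flipBow-other p q r o) (flipBow-other p′ q′ r′ o′)

-- Connectivity

T⁺ : ∀ {b} → b ≡ true → T b
T⁺ refl = tt

T⁻ : ∀ {b} → T b → b ≡ true
T⁻ {true} _ = refl

-- Walks in `G - v` are written with the vertices of `G`, which avoids renumbering by `punchIn`
-- until connectedness is concluded.
AdjOff : (G : Graph n) → Fin n → Fin n → Fin n → Set
AdjOff G v a b = a ≢ v × b ≢ v × adj G a b ≡ true

WalkOff : (G : Graph n) → Fin n → Fin n → Fin n → Set
WalkOff G v = Star (AdjOff G v)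

walkOff-sym : (G : Graph n) {v a b : Fin n} → WalkOff G v a b → WalkOff G v b a
walkOff-sym G = reverse λ { (a≢v , b≢v , e) → b≢v , a≢v , trans (adj-sym G _ _) e }

walkOff⇒walk : {G : Graph (suc n)} {v a b : Fin (suc n)} → WalkOff G v a b →
               ∀ {i j} → punchIn v i ≡ a → punchIn v j ≡ b → Walk (G - v) i j
walkOff⇒walk {v = v} ε ei ej with punchIn-injective v _ _ (trans ei (sym ej))
... | refl = ε
walkOff⇒walk {G = G} ((_ , c≢v , e) ◅ w) refl ej with punched c≢v
... | k , refl = T⁺ e ◅ walkOff⇒walk {G = G} w refl ej

hub⇒connected : {G : Graph (suc n)} {v : Fin (suc n)} (h : Fin (suc n)) →
                (∀ a → a ≢ v → WalkOff G v a h) → Connected (G - v)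
hub⇒connected {G = G} {v} h toHub i j =
  walkOff⇒walk {G = G} (toHub _ (punchInᵢ≢i v i) ◅◅ walkOff-sym G (toHub _ (punchInᵢ≢i v j))) refl refl

third : (a b : Fin (suc (suc (suc n)))) → ∃ λ v → v ≢ a × v ≢ b
third zero          zero          = suc zero , (λ ()) , λ ()
third zero          (suc zero)    = suc (suc zero) , (λ ()) , λ ()
third zero          (suc (suc _)) = suc zero , (λ ()) , λ ()
third (suc zero)    zero          = suc (suc zero) , (λ ()) , λ ()
third (suc zero)    (suc _)       = zero , (λ ()) , λ ()
third (suc (suc _)) zero          = suc zero , (λ ()) , λ ()
third (suc (suc _)) (suc _)       = zero , (λ ()) , λ ()

-- Two vertices of `G` are joined within the card of a third one.
cards⇒twoConnected : {G : Graph n} → 3 ≤ n → (∀ v → Connected (G - v)) → TwoConnected G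
cards⇒twoConnected {G = G} 3≤n@(s≤s (s≤s (s≤s _))) cards = 3≤n , connected , cards
  where
  connected : Connected G
  connected a b with third a b
  ... | v , v≢a , v≢b with punched (≢-sym v≢a) | punched (≢-sym v≢b)
  ...   | i , refl | j , refl = gmap (punchIn v) (λ e → e) (cards v i j)

-- Domination number 2

pair-∣∣ : {p q : Fin n} → p ≢ q → ∣ ⁅ p ⁆ ∪ ⁅ q ⁆ ∣ ≡ 2
pair-∣∣ {p = zero}  {zero}  p≢q = contradiction refl p≢q
pair-∣∣ {p = zero}  {suc q} p≢q = cong suc (trans (cong ∣_∣ (∪-identityˡ ⁅ q ⁆)) (∣⁅x⁆∣≡1 q))
pair-∣∣ {p = suc p} {zero}  p≢q = cong suc (trans (cong ∣_∣ (∪-identityʳ ⁅ p ⁆)) (∣⁅x⁆∣≡1 p))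
pair-∣∣ {p = suc p} {suc q} p≢q = pair-∣∣ (p≢q ∘ cong suc)

two-elements : {S : Subset n} {s s′ : Fin n} → s ∈ S → s′ ∈ S → s′ ≢ s → 2 ≤ ∣ S ∣
two-elements {S = S} {s} {s′} s∈S s′∈S s′≢s = subst (_< ∣ S ∣) (∣⁅x⁆∣≡1 s)
  (p⊂q⇒∣p∣<∣q∣ ((λ x∈ → subst (_∈ S) (sym (x∈⁅y⁆⇒x≡y s x∈)) s∈S) , s′ , s′∈S , s′≢s ∘ x∈⁅y⁆⇒x≡y s))

NoUniversal : Graph n → Set
NoUniversal G = ∀ u → ∃ λ b → b ≢ u × adj G u b ≡ false

¬false⇒true : ∀ {b} → b ≢ false → b ≡ true
¬false⇒true {true}  _  = refl
¬false⇒true {false} ne = contradiction refl ne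

¬true⇒false : ∀ {b} → b ≢ true → b ≡ false
¬true⇒false {false} _  = refl
¬true⇒false {true}  ne = contradiction refl ne

nonNeighbour? : (G : Graph n) (u : Fin n) → Dec (∃ λ b → b ≢ u × adj G u b ≡ false)
nonNeighbour? G u = any? λ b → ¬? (b ≟ u) ×-dec (adj G u b ≟ᵇ false)

universal? : (G : Graph n) → ∃ (Universal G) ⊎ NoUniversal G
universal? G with any? (λ u → ¬? (nonNeighbour? G u))
... | yes (u , none) = inj₁ (u , λ b b≢u → ¬false⇒true λ e → none (b , b≢u , e))
... | no  ¬univ      = inj₂ λ u → case nonNeighbour? G u of λ where
  (yes found) → found
  (no  none)  → contradiction (u , none) ¬univ

DominatingPair : Graph n → Fin n → Fin n → Set
DominatingPair G p q = ∀ w → (w ≡ p ⊎ w ≡ q) ⊎ (adj G p w ≡ true ⊎ adj G q w ≡ true)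

-- For the lower bound, take `s` in a dominating set and a non-neighbour of `s`: it lies in the set
-- itself or has a dominator there, and either is a second element.
isDominationNumber2 : {G : Graph (suc n)} → NoUniversal G → {p q : Fin (suc n)} → p ≢ q → DominatingPair G p q → IsDominationNumber G 2
isDominationNumber2 {G = G} nu {p} {q} p≢q dom = (⁅ p ⁆ ∪ ⁅ q ⁆ , dominating , pair-∣∣ p≢q) , minimal
  where
  p∈ : p ∈ ⁅ p ⁆ ∪ ⁅ q ⁆
  p∈ = x∈p∪q⁺ (inj₁ (x∈⁅x⁆ p))
  q∈ : q ∈ ⁅ p ⁆ ∪ ⁅ q ⁆
  q∈ = x∈p∪q⁺ {p = ⁅ p ⁆} (inj₂ (x∈⁅x⁆ q))
  dominating : IsDominating G (⁅ p ⁆ ∪ ⁅ q ⁆)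
  dominating w with dom w
  ... | inj₁ (inj₁ refl) = inj₁ p∈
  ... | inj₁ (inj₂ refl) = inj₁ q∈
  ... | inj₂ (inj₁ e)    = inj₂ (p , p∈ , T⁺ e)
  ... | inj₂ (inj₂ e)    = inj₂ (q , q∈ , T⁺ e)
  element : ∀ S → IsDominating G S → ∃ (_∈ S)
  element S d with d zero
  ... | inj₁ z∈        = zero , z∈
  ... | inj₂ (u , u∈ , _) = u , u∈
  minimal : ∀ S → IsDominating G S → 2 ≤ ∣ S ∣
  minimal S d with element S d
  ... | s , s∈ with nu s
  ...   | b , b≢s , e with d b
  ...     | inj₁ b∈           = two-elements s∈ b∈ b≢s
  ...     | inj₂ (u , u∈ , a) = two-elements s∈ u∈ λ { refl → true≢false (T⁻ a) e }

-- The right-hand side of the equivalence, as a hypothesis.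
BasicReconstructible : Set
BasicReconstructible = ∀ (n : ℕ) (G : Graph n) → TwoConnected G →
  IsDominationNumber G 2 ⊎ (IsDiameter G [ 2 ] × IsDiameter (complement G) [ 2 ]) → Reconstructible G

-- Either a single vertex dominates, and is universal, or the pair shows that the domination number
-- is 2.
dominated-≅ : BasicReconstructible → {G H : Graph n} → Hypomorphic G H → TwoConnected G →
              {p q : Fin n} → p ≢ q → DominatingPair G p q → G ≅ H
dominated-≅ basic {G} {H} h tc@(s≤s (s≤s (s≤s _)) , _) p≢q dom with universal? G
... | inj₁ (u , univ) = universal-≅ {G = G} {H} h univ
... | inj₂ nu         = ≅-sym (basic _ G tc (inj₁ (isDominationNumber2 {G = G} nu p≢q dom)) H (Hypomorphic⇒≈ᵈ {G = G} {H} h))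

-- Reconstructing a rooted graph

pend : Graph n → Fin n → Graph (suc n)
pend {n} G r = record { adj = adj′ ; adj-sym = adj-sym′ ; adj-irrefl = adj-irrefl′ }
  where
  adj′ : Fin (suc n) → Fin (suc n) → Bool
  adj′ zero    zero    = false
  adj′ zero    (suc b) = does (b ≟ r)
  adj′ (suc a) zero    = does (a ≟ r)
  adj′ (suc a) (suc b) = adj G a b
  adj-sym′ : ∀ a b → adj′ a b ≡ adj′ b a
  adj-sym′ zero    zero    = refl
  adj-sym′ zero    (suc b) = refl
  adj-sym′ (suc a) zero    = refl
  adj-sym′ (suc a) (suc b) = adj-sym G a b
  adj-irrefl′ : ∀ a → adj′ a a ≡ false
  adj-irrefl′ zero    = refl
  adj-irrefl′ (suc a) = adj-irrefl G a

pend-pendant : (G : Graph n) (r : Fin n) → Pendant (pend G r) zero (suc r)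
pend-pendant G r = dec-true (r ≟ r) refl , λ where
  zero    _  → refl
  (suc b) ne → dec-false (b ≟ r) (ne ∘ cong suc)

pendant-suc : {G : Graph n} {r t : Fin n} → t ≢ r → Pendant G t r → Pendant (pend G r) (suc t) (suc r)
pendant-suc {r = r} {t} t≢r (e , none) = e , λ where
  zero    _  → dec-false (t ≟ r) t≢r
  (suc b) ne → none b (ne ∘ cong suc)

does-≟-perm : (f : Permutation n n) {r : Fin n} → f ⟨$⟩ʳ r ≡ r → ∀ b → does ((f ⟨$⟩ʳ b) ≟ r) ≡ does (b ≟ r)
does-≟-perm f {r} fr b = case b ≟ r of λ where
  (yes refl) → trans (dec-true ((f ⟨$⟩ʳ b) ≟ b) fr) (sym (dec-true (b ≟ b) refl))
  (no  b≢r)  → trans (dec-false ((f ⟨$⟩ʳ b) ≟ r) (λ e → b≢r (⟨$⟩ʳ-injective f (trans e (sym fr)))))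
                     (sym (dec-false (b ≟ r) b≢r))

-- Fixing `r` is what lets the isomorphism extend to the new pendant vertex.
pend-card : {G H : Graph n} {r v : Fin n} (c : Card G H v) → perm c ⟨$⟩ʳ r ≡ r → Card (pend G r) (pend H r) (suc v)
pend-card {G = G} {H} {r} {v} c cr = record { perm = lift₀ (perm c) ; fix = cong suc (fix c) ; pres = pres′ }
  where
  pres′ : ∀ {a b} → a ≢ suc v → b ≢ suc v →
          adj (pend H r) (lift₀ (perm c) ⟨$⟩ʳ a) (lift₀ (perm c) ⟨$⟩ʳ b) ≡ adj (pend G r) a b
  pres′ {zero}  {zero}  _   _   = refl
  pres′ {zero}  {suc b} _   _   = does-≟-perm (perm c) cr b
  pres′ {suc a} {zero}  _   _   = does-≟-perm (perm c) cr a
  pres′ {suc a} {suc b} a≢v b≢v = pres c (a≢v ∘ cong suc) (b≢v ∘ cong suc)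

-- Deleting the new vertex leaves `G` and `H`, so any isomorphism between them gives this card,
-- wherever it sends `r`. This drives the induction on the number of leaves.
pend-card-zero : {G H : Graph n} {r : Fin n} → G ≅ H → Card (pend G r) (pend H r) zero
pend-card-zero {G = G} {H} {r} i = record { perm = lift₀ (bijection i) ; fix = refl ; pres = pres′ }
  where
  pres′ : ∀ {a b} → a ≢ zero → b ≢ zero →
          adj (pend H r) (lift₀ (bijection i) ⟨$⟩ʳ a) (lift₀ (bijection i) ⟨$⟩ʳ b) ≡ adj (pend G r) a b
  pres′ {zero}  a≢0 _   = contradiction refl a≢0
  pres′ {suc a} {zero}  _ b≢0 = contradiction refl b≢0
  pres′ {suc a} {suc b} _ _   = preserves i a b

pendants-twins : {G : Graph n} {P : Fin n → Set} {p q r : Fin n} → Pendant G p r → Pendant G q r → Twins G P p q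
pendants-twins {r = r} (ep , np) (eq , nq) c _ _ _ = case c ≟ r of λ where
  (yes refl) → trans ep (sym eq)
  (no  c≢r)  → trans (np c c≢r) (sym (nq c c≢r))

twins-≅ : {G : Graph n} {p q : Fin n} → Twins G (λ _ → ⊤) p q → G ≅ G
twins-≅ {G = G} {p} {q} tw = record { bijection = swap p q ; preserves = λ _ _ → twins-swap {H = G} tw tt tt }

-- Pendant vertices at a common root are twins, so the card at one of them serves for the others.
swap-card : {G H : Graph n} {p q : Fin n} → Twins G (λ _ → ⊤) q p → Twins H (λ _ → ⊤) p q → Card G H p → Card G H q
swap-card {G = G} {H} {p} {q} twG twH c =
  Card-conj (twins-≅ {G = G} twG) c (twins-≅ {G = H} twH) (swap-matchˡ q p) (swap-matchˡ p q)

-- In the complement `p` is adjacent to everything but `a`, so it is a hub; `a` reaches it through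
-- `c` or `d`, whichever is not deleted.
leaf⇒card-connected : (F : Graph (suc n)) {p a c d w : Fin (suc n)} → Pendant F p a →
  c ≢ a → d ≢ a → c ≢ p → d ≢ p → c ≢ d → adj F a c ≡ false → adj F a d ≡ false →
  w ≢ p → Connected (complement F - w)
leaf⇒card-connected F {p} {a} {c} {d} {w} (pa , none) c≢a d≢a c≢p d≢p c≢d ac ad w≢p = hub⇒connected {G = complement F} p toHub
  where
  edge : ∀ b → b ≢ p → b ≢ a → adj (complement F) b p ≡ true
  edge b b≢p b≢a = co-true F b≢p (trans (adj-sym F b p) (none b b≢a))
  via : ∀ b → b ≢ a → b ≢ p → adj F a b ≡ false → w ≢ b → a ≢ w → WalkOff (complement F) w a p
  via b b≢a b≢p e w≢b a≢w =
    (a≢w , ≢-sym w≢b , co-true F (≢-sym b≢a) e) ◅ (≢-sym w≢b , ≢-sym w≢p , edge b b≢p b≢a) ◅ ε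
  toHub : ∀ b → b ≢ w → WalkOff (complement F) w b p
  toHub b b≢w with b ≟ p | b ≟ a | w ≟ c
  ... | yes refl | _        | _        = ε
  ... | no b≢p   | no b≢a   | _        = (b≢w , ≢-sym w≢p , edge b b≢p b≢a) ◅ ε
  ... | no _     | yes refl | no w≢c   = via c c≢a c≢p ac w≢c b≢w
  ... | no _     | yes refl | yes refl = via d d≢a d≢p ad c≢d b≢w

count-≤ : (g : Fin n → Bool) → count g ≤ n
count-≤ {zero}  g = z≤n
count-≤ {suc n} g with g zero
... | true  = s≤s (count-≤ (g ∘ suc))
... | false = m≤n⇒m≤1+n (count-≤ (g ∘ suc))

module Rooted {N : ℕ} (r : Fin N) where

  embed : ∀ s → Fin N → Fin (s + N)
  embed zero    a = a
  embed (suc s) a = suc (embed s a)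

  root : ∀ s → Fin (s + N)
  root s = embed s r

  leaves : Graph N → ∀ s → Graph (s + N)
  leaves B zero    = B
  leaves B (suc s) = pend (leaves B s) (root s)

  embed-injective : ∀ s {a b} → embed s a ≡ embed s b → a ≡ b
  embed-injective zero    e = e
  embed-injective (suc s) e = embed-injective s (suc-injective e)

  embed-adj : ∀ B s {a b} → adj (leaves B s) (embed s a) (embed s b) ≡ adj B a b
  embed-adj B zero    = refl
  embed-adj B (suc s) = embed-adj B s

  deg-root : ∀ B s → s ≤ deg (leaves B s) (root s)
  deg-root B zero    = z≤n
  deg-root B (suc s) rewrite dec-true (root s ≟ root s) refl = s≤s (deg-root B s)

  -- New leaves do not change the degree of a vertex of `B` other than the root, and a leaf itself
  -- has degree 1.
  deg-nonroot : ∀ B s {a} → a ≢ root s → deg (leaves B s) a ≤ suc N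
  deg-nonroot B zero    {a} _ = m≤n⇒m≤1+n (count-≤ (adj B a))
  deg-nonroot B (suc s) {zero} _ = ≤-trans (≤-reflexive (count-unique (adj (leaves B (suc s)) zero) (root (suc s))
    (proj₁ (pend-pendant (leaves B s) (root s))) (proj₂ (pend-pendant (leaves B s) (root s))))) (s≤s z≤n)
  deg-nonroot B (suc s) {suc a} ne rewrite dec-false (a ≟ root s) (ne ∘ cong suc) = deg-nonroot B s (ne ∘ cong suc)

  module _ {B B′ : Graph N} where

    -- With more than N leaves the root is the unique vertex of largest degree.
    root-fixed : (i : leaves B (2 + N) ≅ leaves B′ (2 + N)) → bijection i ⟨$⟩ʳ root (2 + N) ≡ root (2 + N)
    root-fixed i = case (bijection i ⟨$⟩ʳ root (2 + N)) ≟ root (2 + N) of λ where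
      (yes e)  → e
      (no  ne) → contradiction
        (≤-trans (deg-root B (2 + N)) (≤-trans (≤-reflexive (sym (deg-≅ i (root (2 + N))))) (deg-nonroot B′ (2 + N) ne)))
        (<⇒≱ (n<1+n (suc N)))

    -- The image `w` of the newest leaf is pendant at the root, hence a twin of the newest leaf of
    -- the other graph. After exchanging these two the isomorphism restricts to one leaf fewer and
    -- still fixes the root.
    peel : ∀ s (i : leaves B s ≅ leaves B′ s) → bijection i ⟨$⟩ʳ root s ≡ root s →
           Σ (B ≅ B′) λ j → bijection j ⟨$⟩ʳ r ≡ r
    peel zero    i fixed = i , fixed
    peel (suc s) i fixed = peel s
      (record { bijection = remove zero g ; preserves = preserves′ })
      (suc-injective (trans (shift (root s)) groot))
      where
      F  = leaves B (suc s)
      F′ = leaves B′ (suc s)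
      f  = bijection i
      w  = f ⟨$⟩ʳ zero
      g  = f ∘ₚ swap w zero
      w-root : adj F′ w (root (suc s)) ≡ true
      w-root = trans (cong (adj F′ w) (sym fixed))
                     (trans (preserves i zero (root (suc s))) (proj₁ (pend-pendant (leaves B s) (root s))))
      w-none : ∀ b → b ≢ root (suc s) → adj F′ w b ≡ false
      w-none b b≢ = trans (cong (adj F′ w) (sym (inverseʳ f))) (trans (preserves i zero (f ⟨$⟩ˡ b))
        (proj₂ (pend-pendant (leaves B s) (root s)) _
          λ e → b≢ (trans (sym (inverseʳ f)) (trans (cong (f ⟨$⟩ʳ_) e) fixed))))
      gzero : g ⟨$⟩ʳ zero ≡ zero
      gzero = swap-matchˡ w zero
      groot : g ⟨$⟩ʳ root (suc s) ≡ root (suc s)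
      groot = trans (cong (swap w zero ⟨$⟩ʳ_) fixed)
                    (swap-other w zero (λ e → adj⇒≢ F′ w-root (sym e)) λ ())
      shift : ∀ a → suc (remove zero g ⟨$⟩ʳ a) ≡ g ⟨$⟩ʳ suc a
      shift a = lift₀-remove g gzero (suc a)
      preserves′ : ∀ a b → adj F′ (suc (remove zero g ⟨$⟩ʳ a)) (suc (remove zero g ⟨$⟩ʳ b)) ≡ adj F (suc a) (suc b)
      preserves′ a b = trans (cong₂ (adj F′) (shift a) (shift b)) (trans
        (twins-swap {H = F′} {P = λ _ → ⊤}
          (pendants-twins {G = F′} (w-root , w-none) (pend-pendant (leaves B′ s) (root s))) tt tt)
        (preserves i (suc a) (suc b)))

    -- The root-fixing `cards` make the decks agree at every number of leaves. The non-neighbours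
    -- `c` and `d` of the root and the connected complement of `B` make the complements with at
    -- least one leaf 2-connected.
    module _ (basic : BasicReconstructible) (i₀ : B ≅ B′)
             (cards : ∀ v → Σ (Card B B′ v) λ c → perm c ⟨$⟩ʳ r ≡ r)
             {c d : Fin N} (c≢r : c ≢ r) (d≢r : d ≢ r) (c≢d : c ≢ d)
             (rc : adj B r c ≡ false) (rd : adj B r d ≡ false)
             (connected : Connected (complement B)) where

      -- A vertex of `B` has a card isomorphism that survives the addition of leaves; an added leaf
      -- is only recorded as such, its card being supplied by the induction.
      LeafCard : ∀ s → Fin (s + N) → Set
      LeafCard s v = (Σ (Card (leaves B s) (leaves B′ s) v) λ f → perm f ⟨$⟩ʳ root s ≡ root s)
        ⊎ (v ≢ root s × Pendant (leaves B s) v (root s) × Pendant (leaves B′ s) v (root s))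

      leafCard : ∀ s v → LeafCard s v
      leafCard zero    v       = inj₁ (cards v)
      leafCard (suc s) zero    = inj₂ ((λ ()) , pend-pendant (leaves B s) (root s) , pend-pendant (leaves B′ s) (root s))
      leafCard (suc s) (suc v) with leafCard s v
      ... | inj₁ (f , e)      = inj₁ (pend-card f e , cong suc e)
      ... | inj₂ (ne , p , p′) = inj₂ (ne ∘ suc-injective , pendant-suc {G = leaves B s} ne p , pendant-suc {G = leaves B′ s} ne p′)

      -- The card at the newest leaf is the graph with one leaf fewer, covered by `i`; the other
      -- leaves are its twins.
      leaves-hypo : ∀ s → leaves B s ≅ leaves B′ s → Hypomorphic (leaves B (suc s)) (leaves B′ (suc s))
      leaves-hypo s i v with leafCard (suc s) v
      ... | inj₁ (f , _)      = f
      ... | inj₂ (_ , p , p′) = swap-card {G = leaves B (suc s)} {H = leaves B′ (suc s)}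
        (pendants-twins {G = leaves B (suc s)} p (pend-pendant (leaves B s) (root s)))
        (pendants-twins {G = leaves B′ (suc s)} (pend-pendant (leaves B′ s) (root s)) p′)
        (pend-card-zero i)

      -- Deleting the only leaf leaves the complement of `B`. Otherwise a leaf survives as hub: the
      -- previous one if the newest is deleted, the newest one in all other cases.
      cards-connected : ∀ s v → Connected (complement (leaves B (suc s)) - v)
      cards-connected zero zero = connected
      cards-connected (suc s) zero = leaf⇒card-connected (leaves B (suc (suc s)))
        {p = suc zero} {a = root (suc (suc s))} {c = embed (suc (suc s)) c} {d = embed (suc (suc s)) d} {w = zero}
        (pendant-suc {G = leaves B (suc s)} (λ ()) (pend-pendant (leaves B s) (root s)))
        (c≢r ∘ embed-injective (suc (suc s))) (d≢r ∘ embed-injective (suc (suc s))) (λ ()) (λ ())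
        (c≢d ∘ embed-injective (suc (suc s))) (trans (embed-adj B s) rc) (trans (embed-adj B s) rd) (λ ())
      cards-connected s (suc v) = leaf⇒card-connected (leaves B (suc s))
        {p = zero} {a = root (suc s)} {c = embed (suc s) c} {d = embed (suc s) d} {w = suc v}
        (pend-pendant (leaves B s) (root s))
        (c≢r ∘ embed-injective (suc s)) (d≢r ∘ embed-injective (suc s)) (λ ()) (λ ())
        (c≢d ∘ embed-injective (suc s)) (trans (embed-adj B s) rc) (trans (embed-adj B s) rd) (λ ())

      3≤N : 3 ≤ N
      3≤N = three c d r c≢d c≢r d≢r
        where
        three : ∀ {k} (a b e : Fin k) → a ≢ b → a ≢ e → b ≢ e → 3 ≤ k
        three {suc (suc (suc k))} _ _ _ _ _ _ = s≤s (s≤s (s≤s z≤n))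
        three {1} zero zero _ ab _ _ = contradiction refl ab
        three {2} zero zero _ ab _ _ = contradiction refl ab
        three {2} zero (suc zero) zero _ ae _ = contradiction refl ae
        three {2} zero (suc zero) (suc zero) _ _ be = contradiction refl be
        three {2} (suc zero) zero zero _ _ be = contradiction refl be
        three {2} (suc zero) zero (suc zero) _ ae _ = contradiction refl ae
        three {2} (suc zero) (suc zero) _ ab _ _ = contradiction refl ab

      -- In the complement the newest leaf misses only the root, so these two vertices dominate and
      -- `basic` applies to the complement.
      leaves-≅ : ∀ s → leaves B s ≅ leaves B′ s
      leaves-≅ zero    = i₀
      leaves-≅ (suc s) = complement-≅⁻¹ {G = F} {H = leaves B′ (suc s)}
        (dominated-≅ basic {G = complement F} {H = complement (leaves B′ (suc s))}
          (complement-hypo (leaves-hypo s (leaves-≅ s)))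
          (cards⇒twoConnected {G = complement F} (≤-trans 3≤N (m≤n+m N (suc s))) (cards-connected s))
          {p = zero} {q = root (suc s)} (λ ()) dominating)
        where
        F = leaves B (suc s)
        dominating : DominatingPair (complement F) zero (root (suc s))
        dominating w = case w ≟ zero of λ where
          (yes e)   → inj₁ (inj₁ e)
          (no  w≢0) → case w ≟ root (suc s) of λ where
            (yes e)   → inj₁ (inj₂ e)
            (no  w≢r) → inj₂ (inj₁ (co-true F (≢-sym w≢0) (proj₂ (pend-pendant (leaves B s) (root s)) w w≢r)))

      -- `i₀` alone may move the root. With `2 + N` leaves the root is recognised by its degree, and
      -- peeling the leaves off keeps it fixed.
      rooted-≅ : Σ (B ≅ B′) λ j → bijection j ⟨$⟩ʳ r ≡ r
      rooted-≅ = peel (2 + N) (leaves-≅ (2 + N)) (root-fixed (leaves-≅ (2 + N)))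

-- A vertex missing one vertex and carrying a pendant vertex

NoIsolated : Graph n → Set
NoIsolated G = ∀ a → ∃ λ b → adj G a b ≡ true

Hypomorphic-sym : {G H : Graph n} → Hypomorphic G H → Hypomorphic H G
Hypomorphic-sym h v = Card-sym (h v)

noIsolated-hypo : {G H : Graph (suc (suc (suc n)))} → Hypomorphic G H → NoIsolated G → NoIsolated H
noIsolated-hypo {G = G} {H} h ni a with any? (λ b → adj H a b ≟ᵇ true)
... | yes found = found
... | no  none  = ⊥-elim (true≢false (proj₂ (ni a))
  (isolated-hypo (Hypomorphic-sym {G = G} {H} h) (λ b → ¬true⇒false λ e → none (b , e)) (proj₁ (ni a))))

bowCard : {G H : Graph n} {v u w t s : Fin n} (c : Card G H v) → Bow H (_≢ v) u w t s →
          u ≢ v → w ≢ v → t ≢ v → s ≢ v → Card G H v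
bowCard {H = H} {v} {u} {w} {t} {s} c bow u≢v w≢v t≢v s≢v = record
  { perm = perm c ∘ₚ flipBow u w t s
  ; fix  = trans (cong (flipBow u w t s ⟨$⟩ʳ_) (fix c)) (flipBow-other bow (≢-sym u≢v) (≢-sym w≢v) (≢-sym t≢v) (≢-sym s≢v))
  ; pres = λ a≢v b≢v → trans (flipBow-pres bow u≢v w≢v t≢v s≢v (avoids c a≢v) (avoids c b≢v)) (pres c a≢v b≢v)
  }

pendant-card : {G H : Graph n} {v t u : Fin n} (c : Card G H v) → Pendant G t u → t ≢ v →
               ∀ b → b ≢ v → b ≢ perm c ⟨$⟩ʳ u → adj H (perm c ⟨$⟩ʳ t) b ≡ false
pendant-card {H = H} c (_ , none) t≢v b b≢v b≢fu =
  trans (cong (adj H (perm c ⟨$⟩ʳ _)) (sym (inverseʳ (perm c))))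
        (trans (pres c t≢v (avoidsˡ c b≢v))
               (none _ λ e → b≢fu (trans (sym (inverseʳ (perm c))) (cong (perm c ⟨$⟩ʳ_) e))))

-- The case `x = v` is included: then the image of `u` is universal in `H - v`.
misses-card : {G H : Graph n} {v u x : Fin n} (c : Card G H v) → Misses G u x → u ≢ v →
              ∀ b → b ≢ v → b ≢ perm c ⟨$⟩ʳ u → b ≢ perm c ⟨$⟩ʳ x → adj H (perm c ⟨$⟩ʳ u) b ≡ true
misses-card {H = H} c m u≢v b b≢v b≢fu b≢fx =
  trans (cong (adj H (perm c ⟨$⟩ʳ _)) (sym (inverseʳ (perm c))))
        (trans (pres c u≢v (avoidsˡ c b≢v)) (others m _ (back b≢fu) (back b≢fx)))
  where
  back : ∀ {a} → b ≢ perm c ⟨$⟩ʳ a → perm c ⟨$⟩ˡ b ≢ a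
  back ne e = ne (trans (sym (inverseʳ (perm c))) (cong (perm c ⟨$⟩ʳ_) e))

remove-card : {G H : Graph (suc n)} {t : Fin (suc n)} {i : Fin n} (c : Card G H (punchIn t i)) →
              perm c ⟨$⟩ʳ t ≡ t → Card (G - t) (H - t) i
remove-card {n} {G} {H} {t} {i} c ct = record
  { perm = remove t (perm c)
  ; fix  = punchIn-injective t _ _ (trans (shift i) (fix c))
  ; pres = λ {a} {b} a≢i b≢i → trans (cong₂ (adj H) (shift a) (shift b))
             (pres c (a≢i ∘ punchIn-injective t _ _) (b≢i ∘ punchIn-injective t _ _))
  }
  where
  shift : ∀ j → punchIn t (remove t (perm c) ⟨$⟩ʳ j) ≡ perm c ⟨$⟩ʳ punchIn t j
  shift j = trans (cong (λ w → punchIn w (remove t (perm c) ⟨$⟩ʳ j)) (sym ct)) (sym (punchIn-permute (perm c) t j))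

remove-fix : (f : Permutation (suc n) (suc n)) {t : Fin (suc n)} {i : Fin n} →
             f ⟨$⟩ʳ t ≡ t → f ⟨$⟩ʳ punchIn t i ≡ punchIn t i → remove t f ⟨$⟩ʳ i ≡ i
remove-fix f {t} {i} ft fi = punchIn-injective t _ _
  (trans (cong (λ w → punchIn w (remove t f ⟨$⟩ʳ i)) (sym ft)) (trans (sym (punchIn-permute f t i)) fi))

module PendantAt {G H : Graph (suc (suc (suc n)))} (h : Hypomorphic G H) {u x t : Fin (suc (suc (suc n)))}
                 (mG : Misses G u x) (mH : Misses H u x) (pG : Pendant G t u) (pH : Pendant H t u) where

  t≢u : t ≢ u
  t≢u = adj⇒≢ G (proj₁ pG)

  t≢x : t ≢ x
  t≢x refl = true≢false (proj₁ pG) (trans (adj-sym G t u) (missed mG))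

  -- Fixing `t` lets the isomorphism restrict to a card of `G - t`, and fixing `u` makes it respect
  -- the root there, as `Rooted` asks.
  Marked : Fin (suc (suc (suc n))) → Set
  Marked v = Σ (Card G H v) λ c → perm c ⟨$⟩ʳ t ≡ t × perm c ⟨$⟩ʳ u ≡ u

  -- Once `u` is fixed, `t` and its image have at most the neighbour `u` in `H - v` and agree there,
  -- so they are twins.
  fixLeaf : ∀ {v} (c : Card G H v) → perm c ⟨$⟩ʳ u ≡ u → t ≢ v → Marked v
  fixLeaf {v} c cu t≢v = swapTwins c (avoids c t≢v) t≢v twins , swap-matchˡ w t ,
    trans (cong (swap w t ⟨$⟩ʳ_) cu) (swap-other w t (λ e → t≢u (⟨$⟩ʳ-injective (perm c) (trans (sym e) (sym cu)))) (≢-sym t≢u))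
    where
    w = perm c ⟨$⟩ʳ t
    twins : Twins H (_≢ v) w t
    twins b b≢v _ _ = case b ≟ u of λ where
      (yes refl) → trans (trans (cong (adj H w) (sym cu)) (trans (pres c t≢v (λ e → b≢v e)) (proj₁ pG))) (sym (proj₁ pH))
      (no  b≢u)  → trans (pendant-card c pG t≢v b b≢v (λ e → b≢u (trans e cu))) (sym (proj₂ pH b b≢u))

  marked-u : Marked u
  marked-u = swapTwins c (avoids c t≢u) t≢u twins , swap-matchˡ w t ,
    trans (cong (swap w t ⟨$⟩ʳ_) (fix c)) (swap-other w t (≢-sym (avoids c t≢u)) (≢-sym t≢u))
    where
    c = h u
    w = perm c ⟨$⟩ʳ t
    twins : Twins H (_≢ u) w t
    twins b b≢u _ _ = trans (pendant-card c pG t≢u b b≢u (λ e → b≢u (trans e (fix c)))) (sym (proj₂ pH b b≢u))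

  -- With `x` deleted, `u` and its image are both universal, hence twins; `fixLeaf` then corrects
  -- `t`.
  marked-x : Marked x
  marked-x = fixLeaf (swapTwins c (avoids c (distinct mG)) (distinct mG) twins) (swap-matchˡ w u) t≢x
    where
    c = h x
    w = perm c ⟨$⟩ʳ u
    twins : Twins H (_≢ x) w u
    twins b b≢x b≢w b≢u = trans (misses-card c mG (distinct mG) b b≢x b≢w (λ e → b≢x (trans e (fix c))))
                                (sym (others mH b b≢u b≢x))

  module _ {z y : Fin (suc (suc (suc n)))} (xz : adj G x z ≡ true) (z≢u : z ≢ u) (z≢t : z ≢ t)
           (y≢u : y ≢ u) (y≢t : y ≢ t) (y≢x : y ≢ x) (y≢z : y ≢ z) where

    z≢x : z ≢ x
    z≢x = ≢-sym (adj⇒≢ G xz)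

    another : ∀ v → ∃ λ b → b ≢ v × b ≢ u × b ≢ t × b ≢ x
    another v with z ≟ v
    ... | no  z≢v  = z , z≢v , z≢u , z≢t , z≢x
    ... | yes refl = y , y≢z , y≢u , y≢t , y≢x

    -- Let `w` and `s` be the images of `u` and `t`. If `w` is not `u`, then `s`, whose only
    -- neighbour in `H - v` is `w`, misses `u` and so is `x`; likewise `w` misses `t`, so `t` is the
    -- image of `x`. Thus t - u - w - s is a bow of `H - v`, and reversing it restores both marks.
    marked-other : ∀ {v} → v ≢ u → v ≢ t → v ≢ x → Marked v
    marked-other {v} v≢u v≢t v≢x with (perm (h v) ⟨$⟩ʳ u) ≟ u
    ... | yes e   = fixLeaf (h v) e (≢-sym v≢t)
    ... | no  w≢u = bowCard c bow u≢v w≢v t≢v s≢v , flipBow-s bow , flipBow-w bow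
      where
      c = h v
      w = perm c ⟨$⟩ʳ u
      s = perm c ⟨$⟩ʳ t
      b = proj₁ (another v)
      b≢v = proj₁ (proj₂ (another v))
      b≢u = proj₁ (proj₂ (proj₂ (another v)))
      b≢t = proj₁ (proj₂ (proj₂ (proj₂ (another v))))
      b≢x = proj₂ (proj₂ (proj₂ (proj₂ (another v))))
      u≢v = ≢-sym v≢u
      t≢v = ≢-sym v≢t
      w≢v = avoids c u≢v
      s≢v = avoids c t≢v
      onlyNbr : ∀ {a} → a ≢ v → adj H s a ≡ true → a ≡ w
      onlyNbr {a} a≢v e = case a ≟ w of λ where
        (yes a≡w) → a≡w
        (no  a≢w) → ⊥-elim (true≢false e (pendant-card c pG t≢v a a≢v a≢w))
      onlyNbrᵗ : ∀ {a} → adj H t a ≡ true → a ≡ u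
      onlyNbrᵗ {a} e = case a ≟ u of λ where
        (yes a≡u) → a≡u
        (no  a≢u) → ⊥-elim (true≢false e (proj₂ pH a a≢u))
      -- The vertex `b` from `another` gives `u` a second neighbour besides `t` that survives the
      -- deletion of `v`. So neither `w` nor `u` has just one neighbour in `H - v`, which separates
      -- them from `t` and `s`.
      t≢w : t ≢ w
      t≢w e = b≢t (⟨$⟩ʳ-injective (perm c) (trans
        (onlyNbrᵗ (trans (cong (λ a → adj H a (perm c ⟨$⟩ʳ b)) e) (trans (pres c u≢v b≢v) (others mG b b≢u b≢x))))
        (sym (onlyNbrᵗ (trans (cong (λ a → adj H a s) e) (trans (pres c u≢v t≢v) (trans (adj-sym G u t) (proj₁ pG))))))))
      s≢u : s ≢ u
      s≢u e = b≢t (trans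
        (onlyNbr b≢v (trans (cong (λ a → adj H a b) e) (others mH b b≢u b≢x)))
        (sym (onlyNbr t≢v (trans (cong (λ a → adj H a t) e) (trans (adj-sym H u t) (proj₁ pH))))))
      s-w : adj H s w ≡ true
      s-w = trans (pres c t≢v u≢v) (proj₁ pG)
      s≡x : s ≡ x
      s≡x = misses-unique mH s≢u (trans (adj-sym H u s) (pendant-card c pG t≢v u u≢v (≢-sym w≢u)))
      fx≡t : perm c ⟨$⟩ʳ x ≡ t
      fx≡t = case t ≟ (perm c ⟨$⟩ʳ x) of λ where
        (yes e) → sym e
        (no ne) → ⊥-elim (true≢false (misses-card c mG u≢v t t≢v t≢w ne) (trans (adj-sym H w t) (proj₂ pH w w≢u)))
      bow : Bow H (_≢ v) u w t s
      bow = record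
        { u≢w = ≢-sym w≢u ; t≢u = t≢u ; t≢w = t≢w ; s≢u = s≢u ; s≢w = adj⇒≢ H s-w
        ; t≢s = λ e → w≢u (onlyNbrᵗ (trans (cong (λ a → adj H a w) e) s-w))
        ; rowu = λ a _ a≢u a≢s → others mH a a≢u (λ e → a≢s (trans e (sym s≡x)))
        ; roww = λ a a≢v a≢w a≢t → misses-card c mG u≢v a a≢v a≢w (λ e → a≢t (trans e fx≡t))
        ; rowt = λ a _ a≢u → proj₂ pH a a≢u
        ; rows = λ a a≢v a≢w → pendant-card c pG t≢v a a≢v a≢w
        }

    marked : ∀ v → v ≢ t → Marked v
    marked v v≢t with v ≟ u | v ≟ x
    ... | yes refl | _        = marked-u
    ... | no _     | yes refl = marked-x
    ... | no v≢u   | no v≢x   = marked-other v≢u v≢t v≢x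

    -- `G - t` is connected through `u`, with `x` attached by `z`, and in its complement `B` the
    -- root misses `z` and `y`. The isomorphism fixing the root extends to `t`, whose only neighbour
    -- is the root.
    large-≅ : BasicReconstructible → G ≅ H
    large-≅ basic with punched (≢-sym t≢u) | punched z≢t | punched y≢t
    ... | r , refl | z₀ , refl | y₀ , refl = extend-card cardT row
      where
      B  = complement (G - t)
      B′ = complement (H - t)
      cards : ∀ i → Σ (Card B B′ i) λ c → perm c ⟨$⟩ʳ r ≡ r
      cards i with marked (punchIn t i) (punchInᵢ≢i t i)
      ... | c , ct , cu = complement-card (remove-card c ct) , remove-fix (perm c) ct cu
      edge : ∀ {i j} → adj (G - t) i j ≡ true → Adj (complement B) i j
      edge {i} {j} e = T⁺ (co-true B (adj⇒≢ (G - t) e) (co-false (G - t) e))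
      toRoot : ∀ i → Walk (complement B) i r
      toRoot i with punchIn t i ≟ u | punchIn t i ≟ x
      ... | yes e | _ = subst (λ j → Walk (complement B) j r) (sym (punchIn-injective t i r e)) ε
      ... | no _  | yes e = edge {i} {z₀} (trans (cong (λ a → adj G a z) e) xz) ◅
        edge {z₀} {r} (trans (adj-sym G z u) (others mG z z≢u z≢x)) ◅ ε
      ... | no i≢u | no i≢x = edge {i} {r} (trans (adj-sym G _ u) (others mG _ i≢u i≢x)) ◅ ε
      connected : Connected (complement B)
      connected i j = toRoot i ◅◅ reverse (λ {a} {b} → subst T (adj-sym (complement B) a b)) (toRoot j)
      rooted = Rooted.rooted-≅ r {B = B} {B′ = B′} basic (complement-≅ (toCard≅ (h t))) cards {c = z₀} {d = y₀}
        (z≢u ∘ cong (punchIn t)) (y≢u ∘ cong (punchIn t)) (≢-sym y≢z ∘ cong (punchIn t))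
        (co-false (G - t) {r} {z₀} (others mG z z≢u z≢x)) (co-false (G - t) {r} {y₀} (others mG y y≢u y≢x)) connected
      j = proj₁ rooted
      cardT : Card G H t
      cardT = fromCard≅ (complement-≅⁻¹ {G = G - t} {H = H - t} j)
      cu : perm cardT ⟨$⟩ʳ u ≡ u
      cu = trans (insert-punchIn t t (bijection j) r) (cong (punchIn t) (proj₂ rooted))
      row : ∀ b → b ≢ t → adj H t (perm cardT ⟨$⟩ʳ b) ≡ adj G t b
      row b _ = case b ≟ u of λ where
        (yes refl) → trans (cong (adj H t) cu) (trans (proj₁ pH) (sym (proj₁ pG)))
        (no  b≢u)  → trans (proj₂ pH _ (λ e → b≢u (⟨$⟩ʳ-injective (perm cardT) (trans e (sym cu))))) (sym (proj₂ pG b b≢u))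

  module _ {z : Fin (suc (suc (suc n)))} (xzG : adj G x z ≡ true) (xzH : adj H x z ≡ true)
           (all : ∀ b → b ≢ u → b ≢ t → b ≢ x → b ≡ z) where

    rowu : ∀ b → adj H u b ≡ adj G u b
    rowu b with b ≟ u | b ≟ x
    ... | yes refl | _        = trans (adj-irrefl H b) (sym (adj-irrefl G b))
    ... | no _     | yes refl = trans (missed mH) (sym (missed mG))
    ... | no b≢u   | no b≢x   = trans (others mH b b≢u b≢x) (sym (others mG b b≢u b≢x))

    rowt : ∀ b → adj H t b ≡ adj G t b
    rowt b with b ≟ u
    ... | yes refl = trans (proj₁ pH) (sym (proj₁ pG))
    ... | no b≢u   = trans (proj₂ pH b b≢u) (sym (proj₂ pG b b≢u))

    rowx : ∀ b → b ≢ u → b ≢ t → adj H x b ≡ adj G x b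
    rowx b b≢u b≢t with b ≟ x
    ... | yes refl = trans (adj-irrefl H b) (sym (adj-irrefl G b))
    ... | no b≢x with all b b≢u b≢t b≢x
    ...   | refl = trans xzH (sym xzG)

    same : ∀ a b → adj H a b ≡ adj G a b
    same a b with a ≟ u | a ≟ t | b ≟ u | b ≟ t
    ... | yes refl | _        | _        | _        = rowu b
    ... | no _     | yes refl | _        | _        = rowt b
    ... | no _     | no _     | yes refl | _        = trans (adj-sym H a b) (trans (rowu a) (adj-sym G b a))
    ... | no _     | no _     | no _     | yes refl = trans (adj-sym H a b) (trans (rowt a) (adj-sym G b a))
    ... | no a≢u   | no a≢t   | no b≢u   | no b≢t with a ≟ x | b ≟ x
    ...   | yes refl | _        = rowx b b≢u b≢t
    ...   | no _     | yes refl = trans (adj-sym H a b) (trans (rowx a a≢u a≢t) (adj-sym G b a))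
    ...   | no a≢x   | no b≢x   with all a a≢u a≢t a≢x | all b b≢u b≢t b≢x
    ...     | refl | refl = trans (adj-irrefl H a) (sym (adj-irrefl G a))

    -- There are only the vertices `u`, `t`, `x` and `z`. The rows of `u` and `t` are known, and the
    -- one remaining pair `x`, `z` is an edge of both graphs.
    small-≅ : G ≅ H
    small-≅ = record { bijection = idₚ ; preserves = same }

  noncommon : {F : Graph (suc (suc (suc n)))} → Misses F u x → Pendant F t u → ∀ {z} → adj F x z ≡ true → z ≢ u × z ≢ t
  noncommon {F} m p {z} xz =
    (λ { refl → true≢false xz (trans (adj-sym F x u) (missed m)) }) ,
    (λ { refl → true≢false xz (trans (adj-sym F x t) (proj₂ p x (≢-sym (distinct m)))) })

  -- A fifth vertex `y` allows `large-≅`. Otherwise a neighbour of `x` in `H` can only be `z`.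
  pendantAt-≅ : BasicReconstructible → NoIsolated G → G ≅ H
  pendantAt-≅ basic ni with ni x
  ... | z , xz with noncommon mG pG xz
  ...   | z≢u , z≢t with any? (λ y → ¬? (y ≟ u) ×-dec (¬? (y ≟ t) ×-dec (¬? (y ≟ x) ×-dec ¬? (y ≟ z))))
  ...     | yes (y , y≢u , y≢t , y≢x , y≢z) = large-≅ xz z≢u z≢t y≢u y≢t y≢x y≢z basic
  ...     | no none = small-≅ xz xzH all
    where
    all : ∀ b → b ≢ u → b ≢ t → b ≢ x → b ≡ z
    all b b≢u b≢t b≢x with b ≟ z
    ... | yes e   = e
    ... | no  b≢z = contradiction (b , b≢u , b≢t , b≢x , b≢z) none
    xzH : adj H x z ≡ true
    xzH with noIsolated-hypo h ni x
    ... | z′ , xz′ with noncommon mH pH xz′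
    ...   | z′≢u , z′≢t with all z′ z′≢u z′≢t (≢-sym (adj⇒≢ H xz′))
    ...     | refl = xz′

-- If H misses another vertex than G at u, then H - x′ has a universal vertex, and so has G - x′.
missed-candidates : {G H : Graph n} → Hypomorphic G H → {u x x′ t : Fin n} →
  Misses G u x → Misses H u x′ → Pendant G t u → x′ ≡ x ⊎ x′ ≡ t
missed-candidates {G = G} {H} h {u} {x} {x′} {t} mG mH (tu , none) with x′ ≟ x | x′ ≟ t
... | yes e    | _        = inj₁ e
... | no _     | yes e    = inj₂ e
... | no x′≢x  | no x′≢t  = ⊥-elim (absurd x′≢x x′≢t)
  where
  c = Card-sym (h x′)
  w = perm c ⟨$⟩ʳ u
  univ : ∀ b → b ≢ x′ → b ≢ w → adj G w b ≡ true
  univ b b≢x′ b≢w = misses-card c mH (distinct mH) b b≢x′ b≢w (λ e → b≢x′ (trans e (fix c)))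
  x≢u = ≢-sym (distinct mG)
  absurd : x′ ≢ x → x′ ≢ t → ⊥
  absurd x′≢x x′≢t with w ≟ u | w ≟ t
  ... | yes w≡u | _       = true≢false
    (univ x (≢-sym x′≢x) (λ e → x≢u (trans e w≡u))) (trans (cong (λ a → adj G a x) w≡u) (missed mG))
  ... | no _    | yes w≡t = true≢false
    (univ x (≢-sym x′≢x) (λ e → true≢false tu (trans (adj-sym G t u) (trans (cong (adj G u) (sym (trans e w≡t))) (missed mG)))))
    (trans (cong (λ a → adj G a x) w≡t) (none x x≢u))
  ... | no w≢u  | no w≢t  = true≢false (univ t (≢-sym x′≢t) (≢-sym w≢t)) (trans (adj-sym G w t) (none w w≢u))

-- Deletions that leave an isolated vertex

module IsolatedOff (basic : BasicReconstructible) {G H : Graph (suc (suc (suc n)))} (h : Hypomorphic G H) (ni : NoIsolated G)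
                   {u x t : Fin (suc (suc (suc n)))} (mG : Misses G u x) (pG : Pendant G t u) where

  private
    t≢u : t ≢ u
    t≢u = adj⇒≢ G (proj₁ pG)

    t≢x : t ≢ x
    t≢x refl = true≢false (proj₁ pG) (trans (adj-sym G t u) (missed mG))

    -- The image of `t` is isolated in `H - u` but not in `H`, so it hangs at `u`.
    pendantH : Pendant H (perm (h u) ⟨$⟩ʳ t) u
    pendantH with noIsolated-hypo {G = G} {H} h ni (perm (h u) ⟨$⟩ʳ t)
    ... | b , e = (case b ≟ u of λ where
        (yes refl) → e
        (no  b≢u)  → ⊥-elim (true≢false e (none b b≢u))) , none
      where
      none : ∀ b → b ≢ u → adj H (perm (h u) ⟨$⟩ʳ t) b ≡ false
      none b b≢u = pendant-card (h u) pG t≢u b b≢u (λ e → b≢u (trans e (fix (h u))))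

  -- In `H` the vertex `t` has degree 1, and since it is not `x` it is adjacent to `u`; so `t` is
  -- pendant at the same vertex in both graphs.
  same-missed-≅ : {H : Graph (suc (suc (suc n)))} → Hypomorphic G H → Misses H u x → G ≅ H
  same-missed-≅ {H} h mH with pendant-hypo {G = G} {H} h pG
  ... | r , (tr , none) with u ≟ r
  ...   | yes refl = PendantAt.pendantAt-≅ h mG mH pG (tr , none) basic ni
  ...   | no  u≢r  = ⊥-elim (true≢false (others mH t t≢u t≢x) (trans (adj-sym H u t) (none u u≢r)))

  -- Here t – u – z – x is a bow of G, so t and x can be exchanged.
  crossed-≅ : Misses H u t → Pendant H x u → G ≅ H
  crossed-≅ mH pH = ≅-trans (same-missed-≅ {H₂} h₂ m₂) (relabel-≅ τ H)
    where
    c = Card-sym (h t)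
    -- Since `u` misses only `t` in `H`, it is universal in `H - t`, and so its image `w` is
    -- universal in `G - t`. This identifies `w` with the neighbour `z` of the pendant vertex `x` of
    -- `G`.
    w = perm c ⟨$⟩ʳ u
    x≢u = ≢-sym (distinct mG)
    x≢t = ≢-sym t≢x
    w≢t : w ≢ t
    w≢t = avoids c (≢-sym t≢u)
    univ : ∀ b → b ≢ t → b ≢ w → adj G w b ≡ true
    univ b b≢t b≢w = misses-card c mH (≢-sym t≢u) b b≢t b≢w (λ e → b≢t (trans e (fix c)))
    w≢u : w ≢ u
    w≢u e = true≢false (univ x x≢t (λ e′ → x≢u (trans e′ e))) (trans (cong (λ a → adj G a x) e) (missed mG))
    w≢x : w ≢ x
    w≢x e = true≢false (univ u (≢-sym t≢u) (≢-sym w≢u))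
      (trans (cong (λ a → adj G a u) e) (trans (adj-sym G x u) (missed mG)))
    z = proj₁ (pendant-hypo (Hypomorphic-sym {G = G} {H} h) pH)
    pz : Pendant G x z
    pz = proj₂ (pendant-hypo (Hypomorphic-sym {G = G} {H} h) pH)
    w≡z : w ≡ z
    w≡z = case w ≟ z of λ where
      (yes e) → e
      (no ne) → ⊥-elim (true≢false (univ x x≢t (≢-sym w≢x)) (trans (adj-sym G w x) (proj₂ pz w ne)))
    bow : Bow G (λ _ → ⊤) u w t x
    bow = record
      { u≢w = ≢-sym w≢u ; t≢u = t≢u ; t≢w = ≢-sym w≢t ; s≢u = x≢u ; s≢w = ≢-sym w≢x ; t≢s = t≢x
      ; rowu = λ a _ a≢u a≢x → others mG a a≢u a≢x
      ; roww = λ a _ a≢w a≢t → univ a a≢t a≢w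
      ; rowt = λ a _ a≢u → proj₂ pG a a≢u
      ; rows = λ a _ a≢w → proj₂ pz a (λ e → a≢w (trans e (sym w≡z)))
      }
    σ : G ≅ G
    σ = record { bijection = flipBow u w t x ; preserves = λ a b → flipBow-pres bow tt tt tt tt tt tt }
    τ = swap t x
    H₂ = relabel τ H
    j : H ≅ H₂
    j = ≅-sym (relabel-≅ τ H)
    jv : ∀ {a b} → τ ⟨$⟩ʳ b ≡ a → bijection j ⟨$⟩ʳ a ≡ b
    jv e = trans (cong (τ ⟨$⟩ˡ_) (sym e)) (inverseˡ τ)
    -- Relabelling `H` exchanges its cards at `t` and `x`; the automorphism `σ` exchanges those of
    -- `G` to match.
    h₂ : Hypomorphic G H₂
    h₂ v with v ≟ t | v ≟ x
    ... | yes refl | _        = Card-conj {H′ = H₂} σ (h x) j (flipBow-t bow) (jv (swap-matchˡ t x))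
    ... | no _     | yes refl = Card-conj {H′ = H₂} σ (h t) j (flipBow-s bow) (jv (swap-matchʳ t x))
    ... | no v≢t   | no v≢x   = Card-conj {H′ = H₂} ≅-refl (h v) j refl (jv (swap-other t x v≢t v≢x))
    τu : τ ⟨$⟩ʳ u ≡ u
    τu = swap-other t x (≢-sym t≢u) (≢-sym x≢u)
    m₂ : Misses H₂ u x
    m₂ = mkMisses (≢-sym x≢u) (trans (cong₂ (adj H) τu (swap-matchʳ t x)) (missed mH))
      λ b b≢u b≢x → trans (cong (λ a → adj H a (τ ⟨$⟩ʳ b)) τu) (others mH _
        (λ e → b≢u (⟨$⟩ʳ-injective τ (trans e (sym τu))))
        (λ e → b≢x (⟨$⟩ʳ-injective τ (trans e (sym (swap-matchʳ t x))))))

  -- If `u` misses `t` in `H`, the same argument with `G` and `H` exchanged shows that `x` is the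
  -- vertex pendant at `u` in `H`, which is the crossed situation.
  isolatedOff-≅ : G ≅ H
  isolatedOff-≅ with misses-hypo {G = G} {H} h mG
  ... | x′ , mH with missed-candidates h mG mH pG | missed-candidates (Hypomorphic-sym {G = G} {H} h) mH mG pendantH
  ...   | inj₁ refl | _         = same-missed-≅ h mH
  ...   | inj₂ refl | inj₁ x≡t  = contradiction (sym x≡t) t≢x
  ...   | inj₂ refl | inj₂ x≡t′ = crossed-≅ mH (subst (λ a → Pendant H a u) (sym x≡t′) pendantH)

-- Components

-- The component of `x` in `G - u`: `reach` bounds it from above, `base` and `closed` from below.
-- Membership is Boolean so that components of different graphs can be compared by counting.
record Component (G : Graph n) (u x : Fin n) : Set where
  field
    member : Fin n → Bool
    base   : member x ≡ true
    avoid  : ∀ {a} → member a ≡ true → a ≢ u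
    reach  : ∀ {a} → member a ≡ true → WalkOff G u x a
    closed : ∀ {a b} → member a ≡ true → b ≢ u → adj G a b ≡ true → member b ≡ true

open Component public

abstract
  -- The set `{x}` is enlarged by one neighbour at a time until it is closed; this ends because
  -- `_⊃_` is well-founded on subsets.
  component : (G : Graph n) {u x : Fin n} → x ≢ u → Component G u x
  component {n} G {u} {x} x≢u = grow ⁅ x ⁆ (⊃-wellFounded ⁅ x ⁆) (x∈⁅x⁆ x)
      λ a∈ → case x∈⁅y⁆⇒x≡y x a∈ of λ { refl → x≢u , ε }
    where
    grow : (S : Subset n) → Acc _⊃_ S → x ∈ S → (∀ {a} → a ∈ S → a ≢ u × WalkOff G u x a) → Component G u x
    grow S (acc rec) x∈S good
      with any? (λ a → any? λ b → (a ∈? S) ×-dec (¬? (b ≟ u) ×-dec ((adj G a b ≟ᵇ true) ×-dec ¬? (b ∈? S))))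
    ... | yes (a , b , a∈S , b≢u , ab , b∉S) =
      grow (S ∪ ⁅ b ⁆) (rec (p⊆p∪q ⁅ b ⁆ , b , x∈p∪q⁺ {p = S} (inj₂ (x∈⁅x⁆ b)) , b∉S)) (p⊆p∪q ⁅ b ⁆ x∈S)
        λ c∈ → case x∈p∪q⁻ S ⁅ b ⁆ c∈ of λ where
          (inj₁ c∈S) → good c∈S
          (inj₂ c∈b) → case x∈⁅y⁆⇒x≡y b c∈b of λ { refl → b≢u , proj₂ (good a∈S) ◅◅ (proj₁ (good a∈S) , b≢u , ab) ◅ ε }
    ... | no none = record
      { member = λ a → does (a ∈? S)
      ; base   = dec-true (x ∈? S) x∈S
      ; avoid  = λ e → proj₁ (good (back e))
      ; reach  = λ e → proj₂ (good (back e))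
      ; closed = λ {a} {b} e b≢u ab → case b ∈? S of λ where
          (yes b∈S) → dec-true (b ∈? S) b∈S
          (no  b∉S) → contradiction (a , b , back e , b≢u , ab , b∉S) none
      }
      where
      back : ∀ {a} → does (a ∈? S) ≡ true → a ∈ S
      back {a} e with a ∈? S
      ... | yes a∈S = a∈S

component-edge : {G : Graph n} {u x : Fin n} (X : Component G u x) {a b : Fin n} → a ≢ u → b ≢ u → adj G a b ≡ true → member X a ≡ member X b
component-edge {G = G} X {a} {b} a≢u b≢u e with member X a in ma | member X b in mb
... | true  | true  = refl
... | false | false = refl
... | true  | false = ⊥-elim (true≢false (closed X ma b≢u e) mb)
... | false | true  = ⊥-elim (true≢false (closed X mb a≢u (trans (adj-sym G b a) e)) ma)

-- A certificate that `G - u` is disconnected. It names no base vertex, so it is carried along any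
-- isomorphism of the cards at `u`.
record Separation (G : Graph n) (u : Fin n) : Set where
  field
    side     : Fin n → Bool
    sideEdge : ∀ {a b} → a ≢ u → b ≢ u → adj G a b ≡ true → side a ≡ side b
    inner    : Fin n
    outer    : Fin n
    inner≢u  : inner ≢ u
    outer≢u  : outer ≢ u
    differ   : side inner ≢ side outer

open Separation public

walk-side : {G : Graph n} {u : Fin n} (sep : Separation G u) {a b : Fin n} → WalkOff G u a b → side sep a ≡ side sep b
walk-side sep ε = refl
walk-side sep ((a≢u , b≢u , e) ◅ w) = trans (sideEdge sep a≢u b≢u e) (walk-side sep w)

otherSide : {G : Graph n} {u : Fin n} (sep : Separation G u) (z : Fin n) → ∃ λ q → q ≢ u × side sep q ≢ side sep z
otherSide sep z with side sep (inner sep) ≟ᵇ side sep z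
... | no  ne = inner sep , inner≢u sep , ne
... | yes e  = outer sep , outer≢u sep , λ e′ → differ sep (trans e (sym e′))

outside : {G : Graph n} {u x : Fin n} → Separation G u → (X : Component G u x) → ∃ λ y → y ≢ u × member X y ≡ false
outside {x = x} sep X with otherSide sep x
... | y , y≢u , ne = y , y≢u , ¬true⇒false λ e → ne (sym (walk-side sep (reach X e)))

-- Deletions that leave no isolated vertex

NoIsolatedOff : Graph n → Fin n → Set
NoIsolatedOff G u = ∀ a → a ≢ u → ∃ λ b → b ≢ u × adj G a b ≡ true

noIsolatedOff-card : {G H : Graph n} {u : Fin n} → Card G H u → NoIsolatedOff G u → NoIsolatedOff H u
noIsolatedOff-card {H = H} c nI a a≢u with nI _ (avoidsˡ c a≢u)
... | b , b≢u , e = perm c ⟨$⟩ʳ b , avoids c b≢u ,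
  trans (cong (λ w → adj H w (perm c ⟨$⟩ʳ b)) (sym (inverseʳ (perm c)))) (trans (pres c (avoidsˡ c a≢u) b≢u) e)

separation-card : {G H : Graph n} {u : Fin n} → Card G H u → Separation G u → Separation H u
separation-card c sep = record
  { side     = λ a → side sep (perm c ⟨$⟩ˡ a)
  ; sideEdge = λ a≢u b≢u e → sideEdge sep (avoidsˡ c a≢u) (avoidsˡ c b≢u) (trans (presˡ c a≢u b≢u) e)
  ; inner    = perm c ⟨$⟩ʳ inner sep
  ; outer    = perm c ⟨$⟩ʳ outer sep
  ; inner≢u  = avoids c (inner≢u sep)
  ; outer≢u  = avoids c (outer≢u sep)
  ; differ   = λ e → differ sep (trans (sym (cong (side sep) (inverseˡ (perm c)))) (trans e (cong (side sep) (inverseˡ (perm c)))))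
  }

-- A card missing a vertex outside the component of x shows that component together with x.
module MarkedCard {G H : Graph n} (h : Hypomorphic G H) {u x x′ : Fin n} (mG : Misses G u x) (mH : Misses H u x′)
                  (nIG : NoIsolatedOff G u) (nIH : NoIsolatedOff H u) (sepH : Separation H u)
                  (X : Component G u x) {y : Fin n} (y≢u : y ≢ u) (y∉X : member X y ≡ false) where

  Marked : Set
  Marked = Σ (Card G H y) λ c → perm c ⟨$⟩ʳ u ≡ u × perm c ⟨$⟩ʳ x ≡ x′

  ∈⇒≢ : ∀ {a b} → member X a ≡ true → member X b ≡ false → a ≢ b
  ∈⇒≢ a∈ b∉ refl = true≢false a∈ b∉

  x≢y = ∈⇒≢ (base X) y∉X
  u≢y = ≢-sym y≢u
  x≢u = ≢-sym (distinct mG)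
  b₀   = proj₁ (nIG y y≢u)
  b₀≢u = proj₁ (proj₂ (nIG y y≢u))

  yb₀ : adj G y b₀ ≡ true
  yb₀ = proj₂ (proj₂ (nIG y y≢u))

  b₀≢y : b₀ ≢ y
  b₀≢y = ≢-sym (adj⇒≢ G yb₀)

  b₀∉X : member X b₀ ≡ false
  b₀∉X = ¬true⇒false λ e → true≢false (closed X e y≢u (trans (adj-sym G b₀ y) yb₀)) y∉X

  -- Otherwise `u` is universal in `H - y`, so `G - y` has a universal vertex `w`. It is `x` or a
  -- neighbour of `x` other than `u`, hence in `X`, yet it is adjacent to `b₀` outside `X`.
  y≢x′ : y ≢ x′
  y≢x′ refl = true≢false (closed X w∈X b₀≢u (univ b₀ b₀≢y (≢-sym (∈⇒≢ w∈X b₀∉X)))) b₀∉X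
    where
    c = Card-sym (h y)
    w = perm c ⟨$⟩ʳ u
    univ : ∀ b → b ≢ y → b ≢ w → adj G w b ≡ true
    univ b b≢y b≢w = misses-card c mH (distinct mH) b b≢y b≢w (λ e → b≢y (trans e (fix c)))
    w≢u : w ≢ u
    w≢u e = true≢false (univ x x≢y (λ e′ → x≢u (trans e′ e))) (trans (cong (λ a → adj G a x) e) (missed mG))
    w∈X : member X w ≡ true
    w∈X with w ≟ x
    ... | yes e   = trans (cong (member X) e) (base X)
    ... | no  w≢x = closed X (base X) w≢u (trans (adj-sym G x w) (univ x x≢y (≢-sym w≢x)))

  c = h y
  f = perm c
  z = f ⟨$⟩ʳ u
  s = f ⟨$⟩ʳ x

  z≢y : z ≢ y
  z≢y = avoids c u≢y

  s≢y : s ≢ y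
  s≢y = avoids c x≢y

  s≢z : s ≢ z
  s≢z e = x≢u (⟨$⟩ʳ-injective f e)

  rowz : ∀ b → b ≢ y → b ≢ z → b ≢ s → adj H z b ≡ true
  rowz = misses-card c mG u≢y

  zs : adj H z s ≡ false
  zs = trans (pres c u≢y x≢y) (missed mG)

  case-fixed : z ≡ u → Marked
  case-fixed e = c , e , misses-unique mH (λ e′ → s≢z (trans e′ (sym e))) (trans (cong (λ a → adj H a s) (sym e)) zs)

  -- In `H - y` both `u` and `z` miss exactly `x′`.
  case-twin : s ≡ x′ → Marked
  case-twin e = swapTwins c z≢y u≢y twins , swap-matchˡ z u ,
    trans (swap-other z u s≢z (λ e′ → distinct mH (trans (sym e′) e))) e
    where
    twins : Twins H (_≢ y) z u
    twins b b≢y b≢z b≢u = case b ≟ x′ of λ where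
      (yes refl) → trans (cong (adj H z) (sym e)) (trans zs (sym (missed mH)))
      (no  b≢x′) → trans (rowz b b≢y b≢z (λ e′ → b≢x′ (trans e′ e))) (sym (others mH b b≢u b≢x′))

  -- Here `z` misses `u`, so `s` is `u`: in `H - y` the vertices `u` and `z` miss exactly each
  -- other. Exchanging them also takes `s` to `x′`.
  case-antitwin : z ≢ u → z ≡ x′ → Marked
  case-antitwin z≢u e = swapTwins c z≢y u≢y twins , swap-matchˡ z u ,
    trans (cong (swap z u ⟨$⟩ʳ_) s≡u) (trans (swap-matchʳ z u) e)
    where
    s≡u : s ≡ u
    s≡u = case u ≟ s of λ where
      (yes e′) → sym e′
      (no  ne) → ⊥-elim (true≢false (rowz u u≢y (≢-sym z≢u) ne) (trans (cong (λ a → adj H a u) e) (trans (adj-sym H x′ u) (missed mH))))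
    twins : Twins H (_≢ y) z u
    twins b b≢y b≢z b≢u = trans (rowz b b≢y b≢z (λ e′ → b≢u (trans e′ s≡u))) (sym (others mH b b≢u (λ e′ → b≢z (trans e′ (sym e)))))

  -- In the remaining case s is adjacent only to y in H - u, and u and z are the inner vertices of a bow of H - y.
  case-bow : z ≢ u → z ≢ x′ → s ≢ x′ → Marked
  case-bow z≢u z≢x′ s≢x′ = bowCard c bow u≢y z≢y s≢y (≢-sym y≢x′) , flipBow-w bow , flipBow-t bow
    where
    s≢u : s ≢ u
    s≢u e = true≢false (others mH z z≢u z≢x′) (trans (adj-sym H u z) (trans (cong (adj H z) (sym e)) zs))
    -- In `H - u` the vertex `z` can fail to be adjacent only to `s` and `y`, so only these can be
    -- separated from it. If `y` is separated, so is its neighbour, which must be `s`.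
    offSide : ∀ {q} → q ≢ u → side sepH q ≢ side sepH z → q ≡ s ⊎ q ≡ y
    offSide {q} q≢u ne with q ≟ s | q ≟ y
    ... | yes e  | _      = inj₁ e
    ... | no _   | yes e  = inj₂ e
    ... | no q≢s | no q≢y = contradiction
      (sym (sideEdge sepH z≢u q≢u (rowz q q≢y (λ e → ne (cong (side sepH) e)) q≢s))) ne
    s-side : side sepH s ≢ side sepH z
    s-side with otherSide sepH z
    ... | q , q≢u , ne with offSide q≢u ne
    ...   | inj₁ refl = ne
    ...   | inj₂ refl with nIH y y≢u
    ...     | b , b≢u , e with offSide b≢u (λ e′ → ne (trans (sideEdge sepH y≢u b≢u e) e′))
    ...       | inj₁ refl = λ e′ → ne (trans (sideEdge sepH y≢u b≢u e) e′)
    ...       | inj₂ refl = contradiction refl (adj⇒≢ H e)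
    s-only : ∀ b → b ≢ y → b ≢ u → adj H s b ≡ false
    s-only b b≢y b≢u = ¬true⇒false λ e →
      case offSide b≢u (λ e′ → s-side (trans (sideEdge sepH s≢u b≢u e) e′)) of λ where
        (inj₁ refl) → adj⇒≢ H e refl
        (inj₂ b≡y)  → b≢y b≡y
    c⁻ = Card-sym c
    -- The preimage `r` of `u` lies in `X` and misses only `b` in `G - y`, so apart from `u` and `y`
    -- only `b` lies outside `X`. Hence `b` can be adjacent only to `u` in `G - y`, and its image
    -- `x′` only to `z` in `H - y`.
    r = f ⟨$⟩ˡ u
    b = f ⟨$⟩ˡ x′
    fb : f ⟨$⟩ʳ b ≡ x′
    fb = inverseʳ f
    r≢u : r ≢ u
    r≢u e = z≢u (trans (cong (f ⟨$⟩ʳ_) (sym e)) (inverseʳ f))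
    xr : adj G x r ≡ true
    xr = trans (sym (pres c x≢y (avoids c⁻ u≢y))) (trans (cong (adj H s) (inverseʳ f))
      (trans (adj-sym H s u) (others mH s s≢u s≢x′)))
    r∈X : member X r ≡ true
    r∈X = closed X (base X) r≢u xr
    rowr : ∀ a → a ≢ y → a ≢ r → a ≢ b → adj G r a ≡ true
    rowr = misses-card c⁻ mH u≢y
    outside≡b : ∀ {a} → a ≢ y → a ≢ u → member X a ≡ false → a ≡ b
    outside≡b {a} a≢y a≢u a∉X = case a ≟ b of λ where
      (yes e)   → e
      (no  a≢b) → ⊥-elim (true≢false (closed X r∈X a≢u (rowr a a≢y (≢-sym (∈⇒≢ r∈X a∉X)) a≢b)) a∉X)
    b₀≡b : b₀ ≡ b
    b₀≡b = outside≡b b₀≢y b₀≢u b₀∉X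
    b∉X : member X b ≡ false
    b∉X = trans (cong (member X) (sym b₀≡b)) b₀∉X
    b≢u : b ≢ u
    b≢u e = b₀≢u (trans b₀≡b e)
    b≢y : b ≢ y
    b≢y e = b₀≢y (trans b₀≡b e)
    b-only : ∀ a → a ≢ y → a ≢ u → adj G b a ≡ false
    b-only a a≢y a≢u = ¬true⇒false λ e → adj⇒≢ G e (sym (outside≡b a≢y a≢u
      (¬true⇒false λ a∈X → true≢false (closed X a∈X b≢u (trans (adj-sym G a b) e)) b∉X)))
    bow : Bow H (_≢ y) u z s x′
    bow = record
      { u≢w = ≢-sym z≢u ; t≢u = s≢u ; t≢w = s≢z ; s≢u = ≢-sym (distinct mH) ; s≢w = ≢-sym z≢x′ ; t≢s = s≢x′
      ; rowu = λ a _ a≢u a≢x′ → others mH a a≢u a≢x′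
      ; roww = λ a a≢y a≢z a≢s → rowz a a≢y a≢z a≢s
      ; rowt = λ a a≢y a≢u → s-only a a≢y a≢u
      ; rows = λ a a≢y a≢z → trans (cong₂ (adj H) (sym fb) (sym (inverseʳ f))) (trans (pres c b≢y (avoids c⁻ a≢y))
          (b-only _ (avoids c⁻ a≢y) (λ e → a≢z (trans (sym (inverseʳ f)) (cong (f ⟨$⟩ʳ_) e)))))
      }

  abstract
    markedCard : Marked
    markedCard with z ≟ u | s ≟ x′ | z ≟ x′
    ... | yes e  | _       | _       = case-fixed e
    ... | no _   | yes e   | _       = case-twin e
    ... | no ne  | no _    | yes e   = case-antitwin ne e
    ... | no ne  | no ne′  | no ne″  = case-bow ne ne″ ne′

  -- A walk from `x` within `X` avoids `y` and `u`, so its image is a walk from `x′` in `H - u`.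
  markedCard-maps : (X′ : Component H u x′) → ∀ {a} → member X a ≡ true → member X′ (perm (proj₁ markedCard) ⟨$⟩ʳ a) ≡ true
  markedCard-maps X′ a∈X = along (base X) (trans (cong (member X′) (proj₂ (proj₂ markedCard))) (base X′)) (reach X a∈X)
    where
    k = proj₁ markedCard
    along : ∀ {a b} → member X a ≡ true → member X′ (perm k ⟨$⟩ʳ a) ≡ true → WalkOff G u a b → member X′ (perm k ⟨$⟩ʳ b) ≡ true
    along a∈X fa∈X′ ε = fa∈X′
    along a∈X fa∈X′ ((_ , d≢u , e) ◅ w) = along d∈X
        (closed X′ fa∈X′ (λ e′ → d≢u (⟨$⟩ʳ-injective (perm k) (trans e′ (sym (proj₁ (proj₂ markedCard))))))
          (trans (pres k (∈⇒≢ a∈X y∉X) (∈⇒≢ d∈X y∉X)) e)) w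
      where d∈X = closed X a∈X d≢u e

-- Counting and exchanging components

count-permute : (g : Fin n → Bool) (f : Permutation n n) → count (λ a → g (f ⟨$⟩ʳ a)) ≡ count g
count-permute g f = sym (sum-permute (ι ∘ g) f)

count-mono : (g k : Fin n → Bool) → (∀ {a} → g a ≡ true → k a ≡ true) → count g ≤ count k
count-mono {zero}  g k g⇒k = z≤n
count-mono {suc n} g k g⇒k with g zero in g0 | k zero in k0
... | true  | true  = s≤s (count-mono (g ∘ suc) (k ∘ suc) g⇒k)
... | true  | false = ⊥-elim (true≢false (g⇒k g0) k0)
... | false | true  = m≤n⇒m≤1+n (count-mono (g ∘ suc) (k ∘ suc) g⇒k)
... | false | false = count-mono (g ∘ suc) (k ∘ suc) g⇒k

count-equal : (g k : Fin n → Bool) → (∀ {a} → g a ≡ true → k a ≡ true) → count k ≤ count g → ∀ a → g a ≡ k a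
count-equal {suc n} g k g⇒k le a with g zero in g0 | k zero in k0
... | true  | false = ⊥-elim (true≢false (g⇒k g0) k0)
... | false | true  = contradiction (count-mono (g ∘ suc) (k ∘ suc) g⇒k) (<⇒≱ le)
count-equal {suc n} g k g⇒k (s≤s le) zero | true | true = trans g0 (sym k0)
count-equal {suc n} g k g⇒k (s≤s le) (suc a) | true | true = count-equal (g ∘ suc) (k ∘ suc) g⇒k le a
count-equal {suc n} g k g⇒k le zero | false | false = trans g0 (sym k0)
count-equal {suc n} g k g⇒k le (suc a) | false | false = count-equal (g ∘ suc) (k ∘ suc) g⇒k le a

-- f maps X₁ onto X₂.  If the α-preimage of X₂ is X₁ or disjoint from X₁, this is a bijection.
exchange : (X₁ X₂ : Fin n → Bool) (f α : Permutation n n) → Fin n → Fin n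
exchange X₁ X₂ f α a =
  if X₁ a then f ⟨$⟩ʳ a else if X₂ (α ⟨$⟩ʳ a) then α ⟨$⟩ʳ (f ⟨$⟩ˡ (α ⟨$⟩ʳ a)) else α ⟨$⟩ʳ a

module _ (X₁ X₂ : Fin n → Bool) (f α : Permutation n n) where

  exchange-X : ∀ {a} → X₁ a ≡ true → exchange X₁ X₂ f α a ≡ f ⟨$⟩ʳ a
  exchange-X e rewrite e = refl

  exchange-Y : ∀ {a} → X₁ a ≡ false → X₂ (α ⟨$⟩ʳ a) ≡ true → exchange X₁ X₂ f α a ≡ α ⟨$⟩ʳ (f ⟨$⟩ˡ (α ⟨$⟩ʳ a))
  exchange-Y e e′ rewrite e | e′ = refl

  exchange-Z : ∀ {a} → X₁ a ≡ false → X₂ (α ⟨$⟩ʳ a) ≡ false → exchange X₁ X₂ f α a ≡ α ⟨$⟩ʳ a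
  exchange-Z e e′ rewrite e | e′ = refl

-- In the disjoint case `f` takes the place of `α` on `X₁`, and the preimage of `X₂` under `α`
-- receives the vacated place: it is sent by `α` to `X₂`, back by `f` to `X₁`, and on by `α`.
EqualOrDisjoint : (X₁ X₂ : Fin n → Bool) → Permutation n n → Set
EqualOrDisjoint X₁ X₂ α = (∀ a → X₁ a ≡ X₂ (α ⟨$⟩ʳ a)) ⊎ (∀ {a} → X₁ a ≡ true → X₂ (α ⟨$⟩ʳ a) ≡ false)

module Exchange (X₁ X₂ : Fin n → Bool) (f α : Permutation n n)
                (fX : ∀ a → X₁ a ≡ X₂ (f ⟨$⟩ʳ a)) (D : EqualOrDisjoint X₁ X₂ α) where

  ρ  = exchange X₁ X₂ f α
  ρ⁻ = exchange X₂ X₁ (flip f) (flip α)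

  fXˡ : ∀ b → X₂ b ≡ X₁ (f ⟨$⟩ˡ b)
  fXˡ b = trans (cong X₂ (sym (inverseʳ f))) (sym (fX _))

  Y-disjoint : ∀ {a} → X₁ a ≡ false → X₂ (α ⟨$⟩ʳ a) ≡ true → X₂ (ρ a) ≡ false
  Y-disjoint {a} e e′ = case D of λ where
    (inj₁ same) → ⊥-elim (true≢false e′ (trans (sym (same a)) e))
    (inj₂ disj) → trans (cong X₂ (exchange-Y X₁ X₂ f α e e′)) (disj (trans (sym (fXˡ _)) e′))

  Y-preimage : ∀ {a} → X₁ a ≡ false → X₂ (α ⟨$⟩ʳ a) ≡ true → X₁ (α ⟨$⟩ˡ ρ a) ≡ true
  Y-preimage e e′ = trans (cong X₁ (trans (cong (α ⟨$⟩ˡ_) (exchange-Y X₁ X₂ f α e e′)) (inverseˡ α))) (trans (sym (fXˡ _)) e′)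

  Z-image : ∀ {a} → X₁ a ≡ false → X₂ (α ⟨$⟩ʳ a) ≡ false → X₂ (ρ a) ≡ false
  Z-image e e′ = trans (cong X₂ (exchange-Z X₁ X₂ f α e e′)) e′

  Z-preimage : ∀ {a} → X₁ a ≡ false → X₂ (α ⟨$⟩ʳ a) ≡ false → X₁ (α ⟨$⟩ˡ ρ a) ≡ false
  Z-preimage e e′ = trans (cong X₁ (trans (cong (α ⟨$⟩ˡ_) (exchange-Z X₁ X₂ f α e e′)) (inverseˡ α))) e

  X-image : ∀ {a} → X₁ a ≡ true → X₂ (ρ a) ≡ true
  X-image {a} e = trans (cong X₂ (exchange-X X₁ X₂ f α e)) (trans (sym (fX a)) e)

  data View (a : Fin n) : Set where
    inX : X₁ a ≡ true → View a
    inY : X₁ a ≡ false → X₂ (α ⟨$⟩ʳ a) ≡ true → View a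
    inZ : X₁ a ≡ false → X₂ (α ⟨$⟩ʳ a) ≡ false → View a

  view : ∀ a → View a
  view a with X₁ a in e | X₂ (α ⟨$⟩ʳ a) in e′
  ... | true  | _     = inX e
  ... | false | true  = inY e e′
  ... | false | false = inZ e e′

  -- The inverse is the same construction with the two sets exchanged and both permutations
  -- reversed, so this one computation, applied twice, gives both inverse laws.
  ρ⁻ρ : ∀ a → ρ⁻ (ρ a) ≡ a
  ρ⁻ρ a with view a
  ... | inX e    = trans (exchange-X X₂ X₁ (flip f) (flip α) (X-image e))
                         (trans (cong (f ⟨$⟩ˡ_) (exchange-X X₁ X₂ f α e)) (inverseˡ f))
  ... | inY e e′ = trans (exchange-Y X₂ X₁ (flip f) (flip α) (Y-disjoint e e′) (Y-preimage e e′))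
    (trans (cong (λ b → α ⟨$⟩ˡ (f ⟨$⟩ʳ (α ⟨$⟩ˡ b))) (exchange-Y X₁ X₂ f α e e′))
    (trans (cong (λ b → α ⟨$⟩ˡ (f ⟨$⟩ʳ b)) (inverseˡ α)) (trans (cong (α ⟨$⟩ˡ_) (inverseʳ f)) (inverseˡ α))))
  ... | inZ e e′ = trans (exchange-Z X₂ X₁ (flip f) (flip α) (Z-image e e′) (Z-preimage e e′))
    (trans (cong (α ⟨$⟩ˡ_) (exchange-Z X₁ X₂ f α e e′)) (inverseˡ α))

equalOrDisjoint-flip : {X₁ X₂ : Fin n → Bool} {α : Permutation n n} → EqualOrDisjoint X₁ X₂ α → EqualOrDisjoint X₂ X₁ (flip α)
equalOrDisjoint-flip {X₂ = X₂} {α} (inj₁ same) = inj₁ λ b → trans (cong X₂ (sym (inverseʳ α))) (sym (same _))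
equalOrDisjoint-flip {X₁ = X₁} {X₂} {α} (inj₂ disj) = inj₂ λ {b} e → ¬true⇒false λ e′ →
  true≢false e (trans (cong X₂ (sym (inverseʳ α))) (disj e′))

module ComponentCase {G H : Graph n} (h : Hypomorphic G H) {u x x′ : Fin n} (mG : Misses G u x) (mH : Misses H u x′)
                     (nIG : NoIsolatedOff G u) (sepG : Separation G u) where

  private
    nIH  = noIsolatedOff-card (h u) nIG
    sepH = separation-card (h u) sepG
    X₁ = component G (≢-sym (distinct mG))
    X₂ = component H (≢-sym (distinct mH))
    out₁ = outside sepG X₁
    out₂ = outside sepH X₂
    h⁻ : Hypomorphic H G
    h⁻ = Hypomorphic-sym {G = G} {H} h
    module M₁ = MarkedCard h mG mH nIG nIH sepH X₁ (proj₁ (proj₂ out₁)) (proj₂ (proj₂ out₁))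
    module M₂ = MarkedCard h⁻ mH mG nIH nIG sepG X₂ (proj₁ (proj₂ out₂)) (proj₂ (proj₂ out₂))
    α  = perm (h u)
    k  = proj₁ M₁.markedCard
    f  = perm k
    m₁ = member X₁
    m₂ = member X₂

    -- Marked cards in both directions embed each component into the other, so the two have equally
    -- many vertices and `f` maps one onto the other.
    fX : ∀ a → m₁ a ≡ m₂ (f ⟨$⟩ʳ a)
    fX = count-equal m₁ (λ a → m₂ (f ⟨$⟩ʳ a)) (M₁.markedCard-maps X₂)
      (≤-trans (≤-reflexive (count-permute m₂ f))
      (≤-trans (count-mono m₂ (λ a → m₁ (perm (proj₁ M₂.markedCard) ⟨$⟩ʳ a)) (M₂.markedCard-maps X₁))
               (≤-reflexive (count-permute m₁ (perm (proj₁ M₂.markedCard))))))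

    edge-Y : ∀ {a b} → a ≢ u → b ≢ u → adj G a b ≡ true → m₂ (α ⟨$⟩ʳ a) ≡ m₂ (α ⟨$⟩ʳ b)
    edge-Y a≢u b≢u e = component-edge X₂ (avoids (h u) a≢u) (avoids (h u) b≢u) (trans (pres (h u) a≢u b≢u) e)

    edge-Y′ : ∀ {a b} → a ≢ u → b ≢ u → adj H a b ≡ true → m₁ (α ⟨$⟩ˡ a) ≡ m₁ (α ⟨$⟩ˡ b)
    edge-Y′ a≢u b≢u e = component-edge X₁ (avoids (h⁻ u) a≢u) (avoids (h⁻ u) b≢u) (trans (pres (h⁻ u) a≢u b≢u) e)

    walk-Y : ∀ {a b} → WalkOff G u a b → m₂ (α ⟨$⟩ʳ a) ≡ m₂ (α ⟨$⟩ʳ b)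
    walk-Y ε = refl
    walk-Y ((a≢u , b≢u , e) ◅ w) = trans (edge-Y a≢u b≢u e) (walk-Y w)

    -- The component of `x` stays together under `α`, so the image of `x` decides. If it lies in
    -- `X₂`, equal sizes turn inclusion into equality.
    D : EqualOrDisjoint m₁ m₂ α
    D with m₂ (α ⟨$⟩ʳ x) in e
    ... | true  = inj₁ (count-equal m₁ (λ a → m₂ (α ⟨$⟩ʳ a)) (λ a∈ → trans (sym (walk-Y (reach X₁ a∈))) e)
      (≤-reflexive (trans (count-permute m₂ α) (sym (trans (count-cong fX) (count-permute m₂ f))))))
      where
      count-cong : {g k : Fin n → Bool} → (∀ a → g a ≡ k a) → count g ≡ count k
      count-cong g≗k = sum-cong-≗ λ a → cong ι (g≗k a)
    ... | false = inj₂ λ a∈ → trans (sym (walk-Y (reach X₁ a∈))) e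

    module E = Exchange m₁ m₂ f α fX D
    module E⁻ = Exchange m₂ m₁ (flip f) (flip α) E.fXˡ (equalOrDisjoint-flip {X₁ = m₁} {m₂} {α} D)
    open E using (ρ; inX; inY; inZ)

    m₁u : m₁ u ≡ false
    m₁u = ¬true⇒false λ e → avoid X₁ e refl

    m₂u : m₂ u ≡ false
    m₂u = ¬true⇒false λ e → avoid X₂ e refl

    ρu : ρ u ≡ u
    ρu = trans (exchange-Z m₁ m₂ f α m₁u (trans (cong m₂ (fix (h u))) m₂u)) (fix (h u))

    ρx : ρ x ≡ x′
    ρx = trans (exchange-X m₁ m₂ f α (base X₁)) (proj₂ (proj₂ M₁.markedCard))

    P : Permutation n n
    P = permutation ρ E⁻.ρ E⁻.ρ⁻ρ E.ρ⁻ρ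

    ρ≢u : ∀ {a} → a ≢ u → ρ a ≢ u
    ρ≢u a≢u e = a≢u (⟨$⟩ʳ-injective P (trans e (sym ρu)))

    m₁≢y : ∀ {a} → m₁ a ≡ true → a ≢ proj₁ out₁
    m₁≢y a∈ refl = true≢false a∈ (proj₂ (proj₂ out₁))

    apart : (g : Fin n → Bool) {p q : Fin n} → g p ≡ true → g q ≡ false → g p ≢ g q
    apart g e e′ e″ = true≢false e (trans e″ e′)

    -- Vertices told apart by a component or by the image of one under the card isomorphism at `u`
    -- are not adjacent. This settles all pairs from different parts, in both graphs.
    cross : ∀ {a b} → a ≢ u → b ≢ u → m₁ a ≢ m₁ b ⊎ m₂ (α ⟨$⟩ʳ a) ≢ m₂ (α ⟨$⟩ʳ b) →
            m₂ (ρ a) ≢ m₂ (ρ b) ⊎ m₁ (α ⟨$⟩ˡ ρ a) ≢ m₁ (α ⟨$⟩ˡ ρ b) → adj H (ρ a) (ρ b) ≡ adj G a b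
    cross {a} {b} a≢u b≢u nG nH = trans falseH (sym falseG)
      where
      falseG : adj G a b ≡ false
      falseG = ¬true⇒false λ e → case nG of λ where
        (inj₁ ne) → ne (component-edge X₁ a≢u b≢u e)
        (inj₂ ne) → ne (edge-Y a≢u b≢u e)
      falseH : adj H (ρ a) (ρ b) ≡ false
      falseH = ¬true⇒false λ e → case nH of λ where
        (inj₁ ne) → ne (component-edge X₂ (ρ≢u a≢u) (ρ≢u b≢u) e)
        (inj₂ ne) → ne (edge-Y′ (ρ≢u a≢u) (ρ≢u b≢u) e)

    presρ : ∀ {a b} → a ≢ u → b ≢ u → adj H (ρ a) (ρ b) ≡ adj G a b
    presρ {a} {b} a≢u b≢u with E.view a | E.view b
    ... | inX p   | inX q   = trans (cong₂ (adj H) (exchange-X m₁ m₂ f α p) (exchange-X m₁ m₂ f α q)) (pres k (m₁≢y p) (m₁≢y q))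
    -- Adjacency is preserved by `α`, by the inverse of `f` and by `α` again; the middle step stays
    -- within `X₁` and `X₂`, where the marked card is an isomorphism.
    ... | inY p o | inY q r = trans (cong₂ (adj H) (exchange-Y m₁ m₂ f α p o) (exchange-Y m₁ m₂ f α q r))
      (trans (pres (h u) (avoid X₁ ya) (avoid X₁ yb))
      (trans (sym (pres k (m₁≢y ya) (m₁≢y yb)))
      (trans (cong₂ (adj H) (inverseʳ f) (inverseʳ f)) (pres (h u) a≢u b≢u))))
      where
      ya = trans (sym (E.fXˡ _)) o
      yb = trans (sym (E.fXˡ _)) r
    ... | inZ p o | inZ q r = trans (cong₂ (adj H) (exchange-Z m₁ m₂ f α p o) (exchange-Z m₁ m₂ f α q r)) (pres (h u) a≢u b≢u)
    ... | inX p   | inY q r = cross a≢u b≢u (inj₁ (apart m₁ p q)) (inj₁ (apart m₂ (E.X-image p) (E.Y-disjoint q r)))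
    ... | inX p   | inZ q r = cross a≢u b≢u (inj₁ (apart m₁ p q)) (inj₁ (apart m₂ (E.X-image p) (E.Z-image q r)))
    ... | inY p o | inX q   = cross a≢u b≢u (inj₁ (≢-sym (apart m₁ q p))) (inj₁ (≢-sym (apart m₂ (E.X-image q) (E.Y-disjoint p o))))
    ... | inZ p o | inX q   = cross a≢u b≢u (inj₁ (≢-sym (apart m₁ q p))) (inj₁ (≢-sym (apart m₂ (E.X-image q) (E.Z-image p o))))
    ... | inY p o | inZ q r = cross a≢u b≢u (inj₂ (apart (λ c → m₂ (α ⟨$⟩ʳ c)) o r))
      (inj₂ (apart (λ c → m₁ (α ⟨$⟩ˡ c)) (E.Y-preimage p o) (E.Z-preimage q r)))
    ... | inZ p o | inY q r = cross a≢u b≢u (inj₂ (≢-sym (apart (λ c → m₂ (α ⟨$⟩ʳ c)) r o)))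
      (inj₂ (≢-sym (apart (λ c → m₁ (α ⟨$⟩ˡ c)) (E.Y-preimage q r) (E.Z-preimage p o))))

  -- `ρ` is an isomorphism from `G - u` to `H - u` that takes the missed vertex `x` to `x′`, so it
  -- extends to `u`.
  componentCase-≅ : G ≅ H
  componentCase-≅ = extend-card (record { perm = P ; fix = ρu ; pres = presρ }) row
    where
    row : ∀ b → b ≢ u → adj H u (ρ b) ≡ adj G u b
    row b b≢u = case b ≟ x of λ where
      (yes refl) → trans (cong (adj H u) ρx) (trans (missed mH) (sym (missed mG)))
      (no  b≢x)  → trans (others mH (ρ b) (ρ≢u b≢u) (λ e → b≢x (⟨$⟩ʳ-injective P (trans e (sym ρx)))))
                         (sym (others mG b b≢u b≢x))

-- A vertex isolated in `G - u` is not isolated in `G`, hence pendant at `u`; the two cases are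
-- whether such a vertex exists.
disconnected-≅ : BasicReconstructible → {G H : Graph (suc (suc (suc n)))} → Hypomorphic G H → NoIsolated G →
                 {u x : Fin (suc (suc (suc n)))} → Misses G u x → Separation G u → G ≅ H
disconnected-≅ basic {G} {H} h ni {u} mG sep
  with any? (λ t → ¬? (t ≟ u) ×-dec ¬? (any? λ b → ¬? (b ≟ u) ×-dec (adj G t b ≟ᵇ true)))
... | yes (t , t≢u , none) = IsolatedOff.isolatedOff-≅ basic h ni mG (tu (ni t) , only)
  where
  only : ∀ b → b ≢ u → adj G t b ≡ false
  only b b≢u = ¬true⇒false λ e → none (b , b≢u , e)
  tu : (∃ λ b → adj G t b ≡ true) → adj G t u ≡ true
  tu (b , e) = case b ≟ u of λ where
    (yes refl) → e
    (no  b≢u)  → ⊥-elim (true≢false e (only b b≢u))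
... | no ¬isolated = ComponentCase.componentCase-≅ h mG (proj₂ (misses-hypo {G = G} {H} h mG)) noIsolatedOff sep
  where
  noIsolatedOff : NoIsolatedOff G u
  noIsolatedOff a a≢u = case any? (λ b → ¬? (b ≟ u) ×-dec (adj G a b ≟ᵇ true)) of λ where
    (yes found) → found
    (no  none)  → contradiction (a , a≢u , none) ¬isolated

connected? : (G : Graph (suc n)) {u v : Fin (suc n)} → v ≢ u →
             Connected (G - u) ⊎ Σ (Component G u v) λ X → ∃ λ c → c ≢ u × member X c ≡ false
connected? G {u} {v} v≢u with any? (λ c → ¬? (c ≟ u) ×-dec (member (component G v≢u) c ≟ᵇ false))
... | yes (c , c≢u , c∉X) = inj₂ (component G v≢u , c , c≢u , c∉X)
... | no  none = inj₁ (hub⇒connected {G = G} v λ a a≢u →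
  walkOff-sym G (reach (component G v≢u) (¬false⇒true λ e → none (a , a≢u , e))))

component-separation : {G : Graph n} {u v c : Fin n} (X : Component G u v) → c ≢ u → member X c ≡ false → Separation G u
component-separation {v = v} {c} X c≢u c∉X = record
  { side = member X ; sideEdge = component-edge X ; inner = v ; outer = c
  ; inner≢u = avoid X (base X) ; outer≢u = c≢u ; differ = λ e → true≢false (base X) (trans e c∉X) }

-- Dominating edges

-- Since `w` also ranges over `u` and `v`, these are adjacent: this is a dominating edge.
TotalDominating : Graph n → Fin n → Fin n → Set
TotalDominating G u v = ∀ w → adj G u w ≡ true ⊎ adj G v w ≡ true

totalDominating? : (G : Graph n) → (∃₂ λ u v → TotalDominating G u v) ⊎
                   (∀ u v → ∃ λ w → adj G u w ≡ false × adj G v w ≡ false)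
totalDominating? {n} G with any? (λ u → any? λ v → ¬? (undominated? u v))
  where
  undominated? : ∀ u v → Dec (∃ λ w → adj G u w ≡ false × adj G v w ≡ false)
  undominated? u v = any? λ w → (adj G u w ≟ᵇ false) ×-dec (adj G v w ≟ᵇ false)
... | yes (u , v , none) = inj₁ (u , v , total)
  where
  total : TotalDominating G u v
  total w with adj G u w in eu | adj G v w in ev
  ... | true  | _     = inj₁ refl
  ... | false | true  = inj₂ refl
  ... | false | false = contradiction (w , eu , ev) none
... | no ¬total = inj₂ λ u v → case any? (λ w → (adj G u w ≟ᵇ false) ×-dec (adj G v w ≟ᵇ false)) of λ where
  (yes found) → found
  (no  none)  → contradiction (u , v , none) ¬total

totalDominating-sym : {G : Graph n} {u v : Fin n} → TotalDominating G u v → TotalDominating G v u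
totalDominating-sym dom w with dom w
... | inj₁ e = inj₂ e
... | inj₂ e = inj₁ e

totalDominating-adj : {G : Graph n} {u v : Fin n} → TotalDominating G u v → adj G u v ≡ true
totalDominating-adj {G = G} {u} {v} dom with dom u
... | inj₁ e = ⊥-elim (true≢false e (adj-irrefl G u))
... | inj₂ e = trans (adj-sym G u v) e

-- Deleting any vertex other than `u` and `v` leaves the dominating edge, which keeps the card
-- connected.
totalDominating-twoConnected : {G : Graph (suc (suc (suc n)))} {u v : Fin (suc (suc (suc n)))} → TotalDominating G u v →
  Connected (G - u) → Connected (G - v) → TwoConnected G
totalDominating-twoConnected {G = G} {u} {v} dom cu cv = cards⇒twoConnected {G = G} (s≤s (s≤s (s≤s z≤n))) cards
  where
  cards : ∀ w → Connected (G - w)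
  cards w with w ≟ u | w ≟ v
  ... | yes refl | _        = cu
  ... | no _     | yes refl = cv
  ... | no w≢u   | no w≢v   = hub⇒connected {G = G} u λ a a≢w → case dom a of λ where
    (inj₁ e) → (a≢w , ≢-sym w≢u , trans (adj-sym G a u) e) ◅ ε
    (inj₂ e) → (a≢w , ≢-sym w≢v , trans (adj-sym G a v) e) ◅
               (≢-sym w≢v , ≢-sym w≢u , trans (adj-sym G v u) (totalDominating-adj {G = G} dom)) ◅ ε

noUniversal⇒noIsolated-complement : {G : Graph n} → NoUniversal G → NoIsolated (complement G)
noUniversal⇒noIsolated-complement {G = G} nu a with nu a
... | b , b≢a , e = b , co-true G (≢-sym b≢a) e

module DominatingEdge (basic : BasicReconstructible) {G H : Graph (suc (suc (suc n)))} (h : Hypomorphic G H)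
                      (nu : NoUniversal G) (ni : NoIsolated G) where

  private
    F = complement G

  twoConnected-≅ : {G H : Graph (suc (suc (suc n)))} → Hypomorphic G H → {u v : Fin (suc (suc (suc n)))} → TotalDominating G u v →
                   Connected (G - u) → Connected (G - v) → G ≅ H
  twoConnected-≅ {G} {H} h dom cu cv = dominated-≅ basic {G = G} {H} h (totalDominating-twoConnected {G = G} dom cu cv)
    (adj⇒≢ G (totalDominating-adj {G = G} dom)) (λ w → inj₂ (dom w))

  -- For x a non-neighbour of u, the edge xc of the complement is dominating.
  module CutVertex {u v : Fin (suc (suc (suc n)))} (dom : TotalDominating G u v) (X : Component G u v)
                   {c : Fin (suc (suc (suc n)))} (c≢u : c ≢ u) (c∉X : member X c ≡ false) where

    x = proj₁ (nu u)

    x≢u : x ≢ u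
    x≢u = proj₁ (proj₂ (nu u))

    ux : adj G u x ≡ false
    ux = proj₂ (proj₂ (nu u))

    -- A non-neighbour of `u` is dominated by `v`, so it lies in the component of `v`.
    missed⇒∈X : ∀ {a} → a ≢ u → adj G u a ≡ false → member X a ≡ true
    missed⇒∈X {a} a≢u ua with dom a
    ... | inj₁ e = ⊥-elim (true≢false e ua)
    ... | inj₂ e = closed X (base X) a≢u e

    x∈X : member X x ≡ true
    x∈X = missed⇒∈X x≢u ux

    v≢x : v ≢ x
    v≢x e = true≢false (totalDominating-adj {G = G} dom) (trans (cong (adj G u) e) ux)

    uc : adj G u c ≡ true
    uc with dom c
    ... | inj₁ e = e
    ... | inj₂ e = ⊥-elim (true≢false (closed X (base X) c≢u e) c∉X)

    coEdge : ∀ {a b} → member X a ≡ true → b ≢ u → member X b ≡ false → adj F a b ≡ true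
    coEdge {a} {b} a∈X b≢u b∉X = co-true G (λ { refl → true≢false a∈X b∉X })
      (¬true⇒false λ e → true≢false (closed X a∈X b≢u e) b∉X)

    domF : TotalDominating F x c
    domF w with member X w in mw
    ... | true  = inj₂ (trans (adj-sym F c w) (coEdge mw c≢u c∉X))
    ... | false = inj₁ (case w ≟ u of λ where
      (yes refl) → co-true G x≢u (trans (adj-sym G x w) ux)
      (no  w≢u)  → coEdge x∈X w≢u mw)

    -- In the complement `k` is adjacent to all of `X`. Other vertices reach it through `v`, and `u`
    -- reaches it through its non-neighbour `q`, which lies in `X`.
    hubCard : ∀ {e k q} → k ≢ u → member X k ≡ false → k ≢ e → v ≢ e → member X q ≡ true → q ≢ e → adj G u q ≡ false →
              Connected (F - e)
    hubCard {e} {k} {q} k≢u k∉X k≢e v≢e q∈X q≢e uq = hub⇒connected {G = F} k toHub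
      where
      toHub : ∀ a → a ≢ e → WalkOff F e a k
      toHub a a≢e with member X a in ma
      ... | true  = (a≢e , k≢e , coEdge ma k≢u k∉X) ◅ ε
      ... | false = case a ≟ u of λ where
        (yes refl) → (a≢e , q≢e , co-true G (≢-sym (avoid X q∈X)) uq) ◅ (q≢e , k≢e , coEdge q∈X k≢u k∉X) ◅ ε
        (no  a≢u)  → (a≢e , v≢e , trans (adj-sym F a v) (coEdge (base X) a≢u ma)) ◅ (v≢e , k≢e , coEdge (base X) k≢u k∉X) ◅ ε

    ∈≢c : ∀ {a} → member X a ≡ true → a ≢ c
    ∈≢c a∈X refl = true≢false a∈X c∉X

    final : Connected (F - x) → Connected (F - c) → G ≅ H
    final cx cc = complement-≅⁻¹ {G = G} {H} (twoConnected-≅ {F} {complement H} (complement-hypo {G = G} {H} h) domF cx cc)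

    -- For `F - x` the hub is `c`, given a second non-neighbour `q` of `u`; without one, `u` misses
    -- only `x` in `G`. For `F - c` the hub is another vertex `k` off `X`; without one, `c` misses
    -- only `u` in `F`, and either `F - c` is connected or `disconnected-≅` applies to `F`.
    cutVertex-≅ : G ≅ H
    cutVertex-≅ with any? (λ a → ¬? (a ≟ u) ×-dec (¬? (a ≟ x) ×-dec (adj G u a ≟ᵇ false)))
    ... | no none = disconnected-≅ basic h ni
      (mkMisses (≢-sym x≢u) ux λ b b≢u b≢x → ¬false⇒true λ e → none (b , b≢u , b≢x , e)) (component-separation X c≢u c∉X)
    ... | yes (q , q≢u , q≢x , uq) with any? (λ k → ¬? (k ≟ u) ×-dec (¬? (k ≟ c) ×-dec (member X k ≟ᵇ false)))
    ...   | yes (k , k≢u , k≢c , k∉X) = final (hubCard c≢u c∉X (≢-sym (∈≢c x∈X)) v≢x (missed⇒∈X q≢u uq) q≢x uq)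
                                             (hubCard k≢u k∉X k≢c (∈≢c (base X)) x∈X (∈≢c x∈X) ux)
    ...   | no none with connected? F {c} {x} (∈≢c x∈X)
    ...     | inj₁ cc = final (hubCard c≢u c∉X (≢-sym (∈≢c x∈X)) v≢x (missed⇒∈X q≢u uq) q≢x uq) cc
    ...     | inj₂ (Y , d , d≢c , d∉Y) = complement-≅⁻¹ {G = G} {H} (disconnected-≅ basic {F} {complement H}
      (complement-hypo {G = G} {H} h) (noUniversal⇒noIsolated-complement {G = G} nu)
      (mkMisses c≢u (co-false G (trans (adj-sym G c u) uc)) λ b b≢c b≢u →
        trans (adj-sym F c b) (coEdge (¬false⇒true λ e → none (b , b≢u , b≢c , e)) c≢u c∉X))
      (component-separation Y d≢c d∉Y))

  dominatingEdge-≅ : {u v : Fin (suc (suc (suc n)))} → TotalDominating G u v → G ≅ H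
  dominatingEdge-≅ {u} {v} dom = go (connected? G (≢-sym u≢v)) (connected? G u≢v)
    where
    u≢v = adj⇒≢ G (totalDominating-adj {G = G} dom)
    go : Connected (G - u) ⊎ (Σ (Component G u v) λ X → ∃ λ c → c ≢ u × member X c ≡ false) →
         Connected (G - v) ⊎ (Σ (Component G v u) λ X → ∃ λ c → c ≢ v × member X c ≡ false) → G ≅ H
    go (inj₁ cu) (inj₁ cv) = twoConnected-≅ {G} {H} h dom cu cv
    go (inj₂ (X , c , c≢u , c∉X)) _ = CutVertex.cutVertex-≅ dom X c≢u c∉X
    go (inj₁ _) (inj₂ (X , c , c≢v , c∉X)) = CutVertex.cutVertex-≅ (totalDominating-sym {G = G} dom) X c≢v c∉X

-- Diameter 2

CommonNeighbours : Graph n → Set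
CommonNeighbours G = ∀ a b → a ≢ b → adj G a b ≡ false → ∃ λ w → adj G a w ≡ true × adj G b w ≡ true

-- The pair `a`, `b` is an edge of the complement that does not dominate there; a vertex it leaves
-- undominated is adjacent to both in `G`.
commonNeighbours : (G : Graph n) → (∀ u v → ∃ λ w → adj (complement G) u w ≡ false × adj (complement G) v w ≡ false) → CommonNeighbours G
commonNeighbours G none a b a≢b ab with none a b
... | w , aw , bw = w , co-false⁻¹ G a≢w aw , co-false⁻¹ G b≢w bw
  where
  a≢w : a ≢ w
  a≢w refl = true≢false (co-true G (≢-sym a≢b) (trans (adj-sym G b a) ab)) bw
  b≢w : b ≢ w
  b≢w refl = true≢false (co-true G a≢b ab) aw

-- A non-neighbour of vertex `zero` realises the distance 2.
isDiameter2 : {G : Graph (suc n)} → NoUniversal G → CommonNeighbours G → IsDiameter G [ 2 ]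
isDiameter2 {G = G} nu cn with nu zero
... | b , b≢0 , e = (zero , b , (walk2 zero b (≢-sym b≢0) e , long)) , bounded
  where
  walk2 : ∀ a b → a ≢ b → adj G a b ≡ false → ∃ λ (w : Walk G a b) → length G w ≡ 2
  walk2 a b a≢b ab with cn a b a≢b ab
  ... | w , aw , bw = T⁺ aw ◅ T⁺ (trans (adj-sym G w b) bw) ◅ ε , refl
  long : (w : Walk G zero b) → 2 ≤ length G w
  long ε           = contradiction refl b≢0
  long (a ◅ ε)     = ⊥-elim (true≢false (T⁻ a) e)
  long (_ ◅ _ ◅ _) = s≤s (s≤s z≤n)
  short : ∀ a b → ∃ λ (w : Walk G a b) → length G w ≤ 2
  short a b with a ≟ b | adj G a b in ab
  ... | yes refl | _     = ε , z≤n
  ... | no _     | true  = T⁺ ab ◅ ε , s≤s z≤n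
  ... | no a≢b   | false with walk2 a b a≢b ab
  ...   | w , l = w , ≤-reflexive l
  bounded : ∀ a b d → IsDistance G a b d → d ≤∞ [ 2 ]
  bounded a b [ k ] (_ , minimal) with short a b
  ... | w , l = [ ≤-trans (minimal w) l ]≤
  bounded a b ⊤⁺ ¬walk = contradiction (proj₁ (short a b)) ¬walk

-- When `v` is deleted, a non-neighbour `z` of `v` is the hub: a common neighbour of `z` and another
-- vertex cannot be `v`.
commonNeighbours-twoConnected : {G : Graph (suc (suc (suc n)))} → NoUniversal G → CommonNeighbours G → TwoConnected G
commonNeighbours-twoConnected {G = G} nu cn = cards⇒twoConnected {G = G} (s≤s (s≤s (s≤s z≤n))) λ v →
  hub⇒connected {G = G} (proj₁ (nu v)) λ a a≢v → toHub a≢v (proj₁ (proj₂ (nu v))) (proj₂ (proj₂ (nu v)))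
  where
  toHub : ∀ {v z a} → a ≢ v → z ≢ v → adj G v z ≡ false → WalkOff G v a z
  toHub {v} {z} {a} a≢v z≢v vz with a ≟ z | adj G a z in az
  ... | yes refl | _     = ε
  ... | no _     | true  = (a≢v , z≢v , az) ◅ ε
  ... | no a≢z   | false with cn a z a≢z az
  ...   | w , aw , zw = (a≢v , w≢v , aw) ◅ (w≢v , z≢v , trans (adj-sym G w z) zw) ◅ ε
    where
    w≢v : w ≢ v
    w≢v refl = true≢false zw (trans (adj-sym G z w) vz)

-- The case distinction on universal vertices and dominating edges

hypomorphic-≅ : BasicReconstructible → {G H : Graph (suc (suc (suc n)))} → Hypomorphic G H → G ≅ H
hypomorphic-≅ basic {G} {H} h = go (universal? G) (universal? F) (totalDominating? G) (totalDominating? F)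
  where
  F = complement G
  hF : Hypomorphic F (complement H)
  hF = complement-hypo {G = G} {H} h
  noIsolated : NoUniversal F → NoIsolated G
  noIsolated nuF a with nuF a
  ... | b , b≢a , e = b , co-false⁻¹ G (≢-sym b≢a) e
  go : ∃ (Universal G) ⊎ NoUniversal G → ∃ (Universal F) ⊎ NoUniversal F →
       (∃₂ λ u v → TotalDominating G u v) ⊎ (∀ u v → ∃ λ w → adj G u w ≡ false × adj G v w ≡ false) →
       (∃₂ λ u v → TotalDominating F u v) ⊎ (∀ u v → ∃ λ w → adj F u w ≡ false × adj F v w ≡ false) → G ≅ H
  go (inj₁ (_ , univ)) _ _ _ = universal-≅ {G = G} {H} h univ
  go _ (inj₁ (_ , univ)) _ _ = complement-≅⁻¹ {G = G} {H} (universal-≅ {G = F} {complement H} hF univ)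
  go (inj₂ nu) (inj₂ nuF) (inj₁ (_ , _ , dom)) _ =
    DominatingEdge.dominatingEdge-≅ basic {G} {H} h nu (noIsolated nuF) dom
  go (inj₂ nu) (inj₂ nuF) _ (inj₁ (_ , _ , dom)) = complement-≅⁻¹ {G = G} {H}
    (DominatingEdge.dominatingEdge-≅ basic {F} {complement H} hF nuF (noUniversal⇒noIsolated-complement {G = G} nu) dom)
  go (inj₂ nu) (inj₂ nuF) (inj₂ none) (inj₂ noneF) = ≅-sym (basic _ G
    (commonNeighbours-twoConnected {G = G} nu cn)
    (inj₂ (isDiameter2 {G = G} nu cn , isDiameter2 {G = F} nuF cnF)) H (Hypomorphic⇒≈ᵈ {G = G} {H} h))
    where
    cn : CommonNeighbours G
    cn = commonNeighbours G noneF
    -- `commonNeighbours` would speak of the complement of `F`, which is not definitionally `G`, so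
    -- its argument is repeated with the roles exchanged.
    cnF : CommonNeighbours F
    cnF a b a≢b ab with none a b
    ... | w , aw , bw = w , co-true G a≢w aw , co-true G b≢w bw
      where
      ab′ : adj G a b ≡ true
      ab′ = co-false⁻¹ G a≢b ab
      a≢w : a ≢ w
      a≢w refl = true≢false (trans (adj-sym G b a) ab′) bw
      b≢w : b ≢ w
      b≢w refl = true≢false ab′ aw

theorem7 : (∀ (n : ℕ) (G : Graph n) → 3 ≤ n → Reconstructible G)
    ⇔
    (∀ (n : ℕ) (G : Graph n) → TwoConnected G →
    IsDominationNumber G 2 ⊎ (IsDiameter G [ 2 ] × IsDiameter (complement G) [ 2 ]) →
    Reconstructible G)
theorem7 = mk⇔
  (λ all n G tc _ {m} → all n G (proj₁ tc) {m})
  (λ basic n G 3≤n {m} → reconstruct basic G 3≤n {m})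
  where
  reconstruct : BasicReconstructible → ∀ {n} (G : Graph n) → 3 ≤ n → Reconstructible G
  reconstruct basic G (s≤s (s≤s (s≤s _))) H p with ≈ᵈ⇒Hypomorphic {H = H} {G = G} p
  ... | H′ , H′≅H , h = ≅-sym (≅-trans (hypomorphic-≅ basic {G} {H′} h) H′≅H)
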